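{- Let $q$ be a prime power with $q\equiv 1\pmod 4$ and let $k$ be a divisor of $q-1$ with $3<k<q-1$ such that $(q-1)/k$ is even. If $(q,k)$ gives a $3$-design, then $k\equiv 1,2,5,10,13,17\pmod{24}$.
   Context: $\mathrm{PSL}(2,q)$ acts on $\mathrm{PG}(1,q)=\mathbb{F}_q\cup\{\infty\}$ by linear fractional transformations. Let $B$ be the subgroup of order $k$ of $\mathbb{F}_q^\times$; $(q,k)$ gives a $3$-design if the $\mathrm{PSL}(2,q)$-orbit $\{gB\}$ is the block set of a $3$-$(q+1,k,\lambda)$ design for some positive integer $\lambda$. -}

module Defs where

open import Data.Nat using (ℕ; zero; suc; _^_; _<_; _≤_)
open import Data.Nat.Primality using (Prime)
open import Data.Fin using (Fin)
open import Data.Fin.Subset using (Subset; _∈_; _∉_; ∣_∣)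
open import Data.Fin.Subset.Properties using (_∈?_; _⊆?_)
open import Data.Fin.Properties using (any?)
open import Data.Bool using (Bool; true; false; if_then_else_)
import Data.Bool.Properties as BoolP
open import Data.Maybe using (Maybe; just; nothing)
import Data.Maybe.Properties as MaybeP
import Data.Vec.Properties as VecP
open import Data.Vec using (Vec; tabulate)
open import Data.List using (List; []; _∷_; filter; length; deduplicate; concatMap; map; allFin)
open import Data.Product using (Σ; ∃; _×_; _,_)
open import Relation.Binary.PropositionalEquality using (_≡_; _≢_)
open import Relation.Binary.Definitions using (DecidableEquality)
open import Relation.Nullary using (does; _×-dec_)
open import Algebra.Structures using (IsCommutativeRing)
open import Function.Bundles using (_↔_; Inverse)

IsPrimePower : ℕ → Set
IsPrimePower q = Σ ℕ λ p → Σ ℕ λ n → Prime p × 1 ≤ n × q ≡ p ^ n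

-- A finite field with exactly q elements (F_q is unique up to isomorphism).
-- Equality is propositional; _⁻¹ is a total function whose value at 0 is
-- irrelevant (only its behaviour on nonzero elements is constrained).
record FiniteField (q : ℕ) : Set₁ where
  infixl 6 _+_
  infixl 7 _*_
  infix 8 -_
  infix 9 _⁻¹
  field
    Carrier : Set
    _+_ _*_ : Carrier → Carrier → Carrier
    -_ : Carrier → Carrier
    0# 1# : Carrier
    _⁻¹ : Carrier → Carrier
    isCommutativeRing : IsCommutativeRing _≡_ _+_ _*_ -_ 0# 1#
    0≢1 : 0# ≢ 1#
    ⁻¹-inverse : ∀ x → x ≢ 0# → x * (x ⁻¹) ≡ 1#
    _≟_ : DecidableEquality Carrier
    enumeration : Fin q ↔ Carrier

module _ {q : ℕ} (F : FiniteField q) where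
  open FiniteField F

  elt : Fin q → Carrier
  elt = Inverse.to enumeration

  -- the projective line PG(1,q) = F_q ∪ {∞}, with nothing = ∞
  Point : Set
  Point = Maybe Carrier

  _≟ₚ_ : DecidableEquality Point
  _≟ₚ_ = MaybeP.≡-dec _≟_

  pt : Fin (suc q) → Point
  pt Fin.zero = nothing
  pt (Fin.suc i) = just (elt i)

  IsSubgroupOfOrder : Subset q → ℕ → Set
  IsSubgroupOfOrder B k =
    (∀ i → elt i ≡ 0# → i ∉ B) ×
    (∃ λ i → elt i ≡ 1# × i ∈ B) ×
    (∀ i j l → i ∈ B → j ∈ B → elt l ≡ elt i * elt j → l ∈ B) ×
    (∀ i j → i ∈ B → elt j ≡ elt i ⁻¹ → j ∈ B) ×
    ∣ B ∣ ≡ k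

  -- matrices (a , b , c , d) standing for [[a , b] , [c , d]]
  Mat : Set
  Mat = Carrier × Carrier × Carrier × Carrier

  det : Mat → Carrier
  det (a , b , c , d) = (a * d) + (- (b * c))

  -- all elements of SL(2,q); PSL(2,q) = SL(2,q)/{±I} acts through them
  SL2 : List Mat
  SL2 = filter (λ m → det m ≟ 1#)
          (concatMap (λ a → concatMap (λ b → concatMap (λ c → map (λ d →
             (elt a , elt b , elt c , elt d)) (allFin q)) (allFin q)) (allFin q)) (allFin q))

  act : Mat → Point → Point
  act (a , b , c , d) (just x) =
    if does ((c * x + d) ≟ 0#) then nothing
    else just ((a * x + b) * ((c * x + d) ⁻¹))
  act (a , b , c , d) nothing =
    if does (c ≟ 0#) then nothing else just (a * (c ⁻¹))

  image : Subset q → Mat → Subset (suc q)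
  image B g = tabulate λ i →
    does (any? (λ j → (j ∈? B) ×-dec (act g (just (elt j)) ≟ₚ pt i)))

  orbit : Subset q → List (Subset (suc q))
  orbit B = deduplicate (VecP.≡-dec BoolP._≟_) (map (image B) SL2)

  Gives3Design : Subset q → Set
  Gives3Design B = Σ ℕ λ lam → 0 < lam ×
    (∀ (T : Subset (suc q)) → ∣ T ∣ ≡ 3 →
       length (filter (λ D → T ⊆? D) (orbit B)) ≡ lam)

{-# OPTIONS --safe #-}

-- For q ≡ 1 (mod 4) the group PSL(2,q) preserves the square class of
-- (a - b)(b - c)(c - a) on triples of PG(1,q), and multiplication by a
-- nonsquare exchanges the two classes.  Counting incidences, a 3-design forces
-- the triples of B to be split evenly between the classes.  Since B consists of
-- squares, normalising a triple to (1 , y , z) shows that both classes contain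
-- the same number W of ordered pairs (y , z), whence 2W = (k - 1)(k - 2).  The
-- symmetries of the pairs then give divisibility:
--   * the swap (y , z) ↦ (z , y) gives 2 ∣ W;
--   * (y , z) ↦ (z/y , 1/y) has order 3, and 3 ∣ k would force fixed points in
--     both classes although its fixed points lie in a single class;
--   * if k ≡ 2 (mod 4) then 4 ∣ W: swap and inversion act freely on the pairs
--     with y z ≠ 1, swap and negation on those with y z = 1.
-- Reducing 2W + 3k = k² + 2 modulo 4 and 8 leaves the stated residues.

module Submission where

open import Defs
open import Algebra.Bundles using (CommutativeRing)
import Algebra.Properties.CommutativeSemigroup
import Algebra.Properties.Ring
import Algebra.Properties.Semiring.Mult.TCOptimised
import Algebra.Solver.Ring
import Algebra.Solver.Ring.AlmostCommutativeRing as ACR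
open import Data.Bool using (true; false; if_then_else_)
import Data.Bool.Properties as Bool
open import Data.Fin as Fin using (Fin; toℕ; fromℕ<)
open import Data.Fin.Patterns using (0F; 1F; 2F; 3F)
import Data.Fin.Properties as Fin
open import Data.Fin.Subset using (Subset; _∪_; ⁅_⁆; ∣_∣) renaming (_∈_ to _∈ₛ_)
open import Data.Fin.Subset.Properties using (_∈?_; _⊆?_; x∈⁅x⁆; x∈⁅y⁆⇒x≡y; x∈p∪q⁻; x∈p∪q⁺)
import Data.Integer
open import Data.Integer as ℤ using (ℤ; -[1+_]; _⊖_)
import Data.Integer.Properties as ℤ
open import Data.List using (List; []; _∷_; _++_; map; allFin; cartesianProduct; concatMap; tabulate; length; filter)
open import Data.List.Membership.Propositional using (_∈_)
open import Data.List.Membership.Propositional.Properties using (∈-map⁻; ∈-filter⁻; ∈-deduplicate⁻)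
open import Data.List.Relation.Unary.Any using (here; there)
open import Data.Maybe using (Maybe; just; nothing)
open import Data.Nat as ℕ using (ℕ; zero; suc; _∸_; _%_; _/_; _<_; _≤_; z≤n; s≤s)
open import Data.Nat.Divisibility using (_∣_; _∣?_; _∣0; divides; ∣1⇒≡1; ∣⇒≤; ∣-trans; ∣m∣n⇒∣m+n; ∣m+n∣m⇒∣n; ∣m⇒∣m*n; ∣n⇒∣m*n; m∣m*n; n∣m*n; *-monoʳ-∣)
open import Data.Nat.DivMod using (m≡m%n+[m/n]*n; m%n<n; [m+kn]%n≡m%n)
import Data.Nat
import Data.Nat.Properties as ℕ
open import Data.Nat.Tactic.RingSolver using (solve-∀)
open import Data.Product using (Σ; ∃; _×_; _,_; proj₁; proj₂; swap)
open import Data.Product.Properties as Product using (,-injective)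
open import Data.Sum using (_⊎_; inj₁; inj₂; [_,_]′)
open import Data.Vec using ([]; _∷_)
open import Data.Vec.Properties using ([]=⇒lookup; lookup⇒[]=; lookup∘tabulate; ≡-dec)
open import Function using (_∘_; Inverse)
open import Level using (0ℓ)
open import Relation.Binary.Definitions using (DecidableEquality)
open import Relation.Binary.PropositionalEquality as ≡ using (_≡_; _≢_; refl; sym; trans; cong; cong₂; subst; module ≡-Reasoning)
import Relation.Binary.Reasoning.Setoid
open import Relation.Nullary using (Dec; yes; no; does; ¬_; ¬?; contradiction; _×-dec_; _⊎-dec_; _→-dec_)
open import Relation.Nullary.Decidable using (map′; dec-true; from-yes; from-no)
open import Relation.Unary using (Pred; Decidable)

-- A square class is handled as an ℕ-valued weight on the field that vanishes at 0 and ignores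
-- nonzero square factors. Degenerate triples then weigh 0, so sums may run over all ordered
-- triples, and an incidence count is an exchange of sums. The parity of (q - 1)/k enters as 2k | q
-- - 1. One count, for subgroups H with 2|H| dividing q - 1, shows that every element of H is a
-- square: for H = B this is the normalisation of triples, and for H = {1, -1}, where it uses q ≡ 1
-- (mod 4), it makes the class of a triple independent of its ordering. The equation 2W + 3k = k² +
-- 2 is used twice. It first feeds the orbit counts: 3 | k would give 2W ≡ 2 (mod 3), so 3 does not
-- divide W and neither class can be free of fixed points; 4 | k would contradict 2 | W, so for even
-- k the subgroup contains -1 but no square root of -1. Only then is it reduced modulo 4 and 8. The
-- pairs with y z = 1 are treated apart because inversion and swap coincide on them, so that their
-- product fixes every such pair.

-- A ring solver with integer coefficients.

module IntegerCoefficients {c ℓ} (R : CommutativeRing c ℓ) where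
  open Data.Integer using (+_)
  open CommutativeRing R hiding (zero) renaming (refl to ≈-refl; sym to ≈-sym; trans to ≈-trans)
  open Algebra.Properties.Ring ring
  open Algebra.Properties.Semiring.Mult.TCOptimised semiring
    using (1+×; ×-homo-+; ×1-homo-*) renaming (_×_ to infixl 8 _×′_)
  open Relation.Binary.Reasoning.Setoid setoid

  fromℤ : ℤ → Carrier
  fromℤ (+ n) = n ×′ 1#
  fromℤ -[1+ n ] = - (suc n ×′ 1#)

  fromℤ-neg : ∀ i → fromℤ (ℤ.- i) ≈ - fromℤ i
  fromℤ-neg (+ zero) = ≈-sym -0#≈0#
  fromℤ-neg (+ suc n) = ≈-refl
  fromℤ-neg -[1+ n ] = ≈-sym (-‿involutive _)

  fromℤ-⊖ : ∀ m n → fromℤ (m ⊖ n) ≈ m ×′ 1# - n ×′ 1#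
  fromℤ-⊖ m zero = ≈-sym (≈-trans (+-congˡ -0#≈0#) (+-identityʳ _))
  fromℤ-⊖ zero (suc n) = ≈-sym (+-identityˡ _)
  fromℤ-⊖ (suc m) (suc n) = begin
    fromℤ (suc m ⊖ suc n)                 ≡⟨ ≡.cong fromℤ (ℤ.[1+m]⊖[1+n]≡m⊖n m n) ⟩
    fromℤ (m ⊖ n)                         ≈⟨ fromℤ-⊖ m n ⟩
    m ×′ 1# - n ×′ 1#                       ≈⟨ +-congʳ (xyx⁻¹≈y 1# (m ×′ 1#)) ⟨
    1# + m ×′ 1# - 1# - n ×′ 1#             ≈⟨ +-assoc _ _ _ ⟩
    1# + m ×′ 1# + (- 1# - n ×′ 1#)         ≈⟨ +-congˡ (-‿+-comm 1# (n ×′ 1#)) ⟩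
    1# + m ×′ 1# - (1# + n ×′ 1#)           ≈⟨ +-cong (1+× m 1#) (-‿cong (1+× n 1#)) ⟨
    suc m ×′ 1# - suc n ×′ 1#               ∎

  fromℤ-+ : ∀ i j → fromℤ (i ℤ.+ j) ≈ fromℤ i + fromℤ j
  fromℤ-+ (+ m) (+ n) = ×-homo-+ 1# m n
  fromℤ-+ (+ m) -[1+ n ] = fromℤ-⊖ m (suc n)
  fromℤ-+ -[1+ m ] (+ n) = ≈-trans (fromℤ-⊖ n (suc m)) (+-comm _ _)
  fromℤ-+ -[1+ m ] -[1+ n ] = begin
    - (suc (suc (m ℕ.+ n)) ×′ 1#)      ≡⟨ ≡.cong (λ k → - (suc k ×′ 1#)) (ℕ.+-suc m n) ⟨
    - ((suc m ℕ.+ suc n) ×′ 1#)        ≈⟨ -‿cong (×-homo-+ 1# (suc m) (suc n)) ⟩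
    - (suc m ×′ 1# + suc n ×′ 1#)       ≈⟨ -‿+-comm _ _ ⟨
    - (suc m ×′ 1#) + - (suc n ×′ 1#)   ∎

  +*-homo : ∀ m j → fromℤ (+ m ℤ.* j) ≈ m ×′ 1# * fromℤ j
  +*-homo m (+ n) =
    ≈-trans (reflexive (≡.cong fromℤ (≡.sym (ℤ.pos-* m n)))) (×1-homo-* m n)
  +*-homo m -[1+ n ] = begin
    fromℤ (+ m ℤ.* -[1+ n ])       ≡⟨ ≡.cong fromℤ (ℤ.neg-distribʳ-* (+ m) (+ suc n)) ⟨
    fromℤ (ℤ.- (+ m ℤ.* + suc n))  ≈⟨ fromℤ-neg (+ m ℤ.* + suc n) ⟩
    - fromℤ (+ m ℤ.* + suc n)      ≈⟨ -‿cong (+*-homo m (+ suc n)) ⟩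
    - (m ×′ 1# * (suc n ×′ 1#))      ≈⟨ -‿distribʳ-* _ _ ⟩
    m ×′ 1# * - (suc n ×′ 1#)        ∎
  fromℤ-* : ∀ i j → fromℤ (i ℤ.* j) ≈ fromℤ i * fromℤ j
  fromℤ-* (+ m) j = +*-homo m j
  fromℤ-* -[1+ m ] j = begin
    fromℤ (-[1+ m ] ℤ.* j)         ≡⟨ ≡.cong fromℤ (ℤ.neg-distribˡ-* (+ suc m) j) ⟨
    fromℤ (ℤ.- (+ suc m ℤ.* j))    ≈⟨ fromℤ-neg (+ suc m ℤ.* j) ⟩
    - fromℤ (+ suc m ℤ.* j)        ≈⟨ -‿cong (+*-homo (suc m) j) ⟩
    - (suc m ×′ 1# * fromℤ j)       ≈⟨ -‿distribˡ-* _ _ ⟩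
    - (suc m ×′ 1#) * fromℤ j       ∎

  ℤ-coefficients : CommutativeRing.rawRing ℤ.+-*-commutativeRing
                   ACR.-Raw-AlmostCommutative⟶ ACR.fromCommutativeRing R
  ℤ-coefficients = record
    { ⟦_⟧ = fromℤ
    ; +-homo = fromℤ-+
    ; *-homo = fromℤ-*
    ; -‿homo = fromℤ-neg
    ; 0-homo = ≈-refl
    ; 1-homo = ≈-refl
    }

  -- Soundness suffices: distinct integers may agree in positive characteristic, and `nothing` then
  -- merely leaves an identity undecided.
  coeff≟ : ∀ i j → Maybe (fromℤ i ≈ fromℤ j)
  coeff≟ i j with i ℤ.≟ j
  ... | yes i≡j = just (reflexive (≡.cong fromℤ i≡j))
  ... | no _ = nothing

  open Algebra.Solver.Ring _ _ ℤ-coefficients coeff≟ public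
    using (solve; _:=_; con; _:+_; _:*_; _:-_; :-_; Polynomial)

  :0 :1 : ∀ {n} → Polynomial n
  :0 = con (+ 0)
  :1 = con (+ 1)

-- Sums of indicators over finite types.

module FiniteSums where
  open Data.Nat using (_+_; _*_)

  open Algebra.Properties.CommutativeSemigroup ℕ.+-commutativeSemigroup using (interchange)

  private variable
    A B : Set
    P Q : Set

  𝟙 : Dec P → ℕ
  𝟙 P? = if does P? then 1 else 0

  𝟙-true : (P? : Dec P) → P → 𝟙 P? ≡ 1
  𝟙-true (yes _) _ = refl
  𝟙-true (no ¬p) p = contradiction p ¬p

  𝟙-false : (P? : Dec P) → ¬ P → 𝟙 P? ≡ 0
  𝟙-false (yes p) ¬p = contradiction p ¬p
  𝟙-false (no _) _ = refl

  𝟙-cong : (P? : Dec P) (Q? : Dec Q) → (P → Q) → (Q → P) → 𝟙 P? ≡ 𝟙 Q?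
  𝟙-cong (yes p) Q? f g = sym (𝟙-true Q? (f p))
  𝟙-cong (no ¬p) Q? f g = sym (𝟙-false Q? (¬p ∘ g))

  𝟙-mono : (P? : Dec P) (Q? : Dec Q) → (P → Q) → 𝟙 P? ≤ 𝟙 Q?
  𝟙-mono (no _) Q? f = z≤n
  𝟙-mono (yes p) Q? f = ℕ.≤-reflexive (sym (𝟙-true Q? (f p)))

  𝟙-holds : (P? : Dec P) → 𝟙 P? ≢ 0 → P
  𝟙-holds (yes p) _ = p
  𝟙-holds (no _) 1≢0 = contradiction refl 1≢0

  𝟙-×-dec : (P? : Dec P) (Q? : Dec Q) → 𝟙 (P? ×-dec Q?) ≡ 𝟙 P? * 𝟙 Q?
  𝟙-×-dec (yes _) (yes _) = refl
  𝟙-×-dec (yes _) (no _) = refl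
  𝟙-×-dec (no _) _ = refl

  ∑ : List A → (A → ℕ) → ℕ
  ∑ [] f = 0
  ∑ (x ∷ xs) f = f x + ∑ xs f

  module _ {f g : A → ℕ} where
    ∑-cong : ∀ xs → (∀ x → f x ≡ g x) → ∑ xs f ≡ ∑ xs g
    ∑-cong [] f≡g = refl
    ∑-cong (x ∷ xs) f≡g = cong₂ _+_ (f≡g x) (∑-cong xs f≡g)

    ∑-mono : ∀ xs → (∀ x → f x ≤ g x) → ∑ xs f ≤ ∑ xs g
    ∑-mono [] f≤g = z≤n
    ∑-mono (x ∷ xs) f≤g = ℕ.+-mono-≤ (f≤g x) (∑-mono xs f≤g)

    -- A strict gap at one member of the list would make the sum of g exceed that of f. This is how
    -- an equality of counts is turned back into a statement about each element.
    ∑-rigid : ∀ {xs x} → (∀ x → f x ≤ g x) → ∑ xs g ≤ ∑ xs f → x ∈ xs → f x ≡ g x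
    ∑-rigid {xs = x ∷ xs} f≤g Σg≤Σf (here refl) = ℕ.≤-antisym (f≤g x)
      (ℕ.+-cancelʳ-≤ (∑ xs f) _ _
        (ℕ.≤-trans (ℕ.+-monoʳ-≤ (g x) (∑-mono xs f≤g)) Σg≤Σf))
    ∑-rigid {xs = x ∷ xs} f≤g Σg≤Σf (there i) = ∑-rigid f≤g
      (ℕ.+-cancelˡ-≤ (f x) _ _
        (ℕ.≤-trans (ℕ.+-monoˡ-≤ (∑ xs g) (f≤g x)) Σg≤Σf)) i

  ∑-cong-∈ : ∀ (xs : List A) {f g : A → ℕ} → (∀ {x} → x ∈ xs → f x ≡ g x) → ∑ xs f ≡ ∑ xs g
  ∑-cong-∈ [] f≡g = refl
  ∑-cong-∈ (x ∷ xs) f≡g = cong₂ _+_ (f≡g (here refl)) (∑-cong-∈ xs (f≡g ∘ there))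

  ∑-zero : ∀ (xs : List A) {f} → (∀ x → f x ≡ 0) → ∑ xs f ≡ 0
  ∑-zero [] f≡0 = refl
  ∑-zero (x ∷ xs) f≡0 = cong₂ _+_ (f≡0 x) (∑-zero xs f≡0)

  ∑-+ : ∀ (xs : List A) f g → ∑ xs (λ x → f x + g x) ≡ ∑ xs f + ∑ xs g
  ∑-+ [] f g = refl
  ∑-+ (x ∷ xs) f g =
    trans (cong (f x + g x +_) (∑-+ xs f g)) (interchange (f x) (g x) (∑ xs f) (∑ xs g))

  ∑-*ˡ : ∀ (xs : List A) c f → ∑ xs (λ x → c * f x) ≡ c * ∑ xs f
  ∑-*ˡ [] c f = sym (ℕ.*-zeroʳ c)
  ∑-*ˡ (x ∷ xs) c f =
    trans (cong (c * f x +_) (∑-*ˡ xs c f)) (sym (ℕ.*-distribˡ-+ c (f x) (∑ xs f)))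

  ∑-*ʳ : ∀ (xs : List A) f c → ∑ xs (λ x → f x * c) ≡ ∑ xs f * c
  ∑-*ʳ xs f c = trans (∑-cong xs (λ x → ℕ.*-comm (f x) c))
    (trans (∑-*ˡ xs c f) (ℕ.*-comm c (∑ xs f)))

  ∑-swap : ∀ (xs : List A) (ys : List B) (f : A → B → ℕ) →
    ∑ xs (λ x → ∑ ys (f x)) ≡ ∑ ys (λ y → ∑ xs (λ x → f x y))
  ∑-swap [] ys f = sym (∑-zero ys (λ _ → refl))
  ∑-swap (x ∷ xs) ys f = trans (cong (∑ ys (f x) +_) (∑-swap xs ys f)) (sym (∑-+ ys _ _))

  ∑-1 : ∀ (xs : List A) → ∑ xs (λ _ → 1) ≡ length xs
  ∑-1 [] = refl
  ∑-1 (x ∷ xs) = cong suc (∑-1 xs)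

  ∑-++ : ∀ (xs ys : List A) f → ∑ (xs ++ ys) f ≡ ∑ xs f + ∑ ys f
  ∑-++ [] ys f = refl
  ∑-++ (x ∷ xs) ys f = trans (cong (f x +_) (∑-++ xs ys f)) (sym (ℕ.+-assoc (f x) _ _))

  ∑-map : ∀ (h : A → B) xs f → ∑ (map h xs) f ≡ ∑ xs (f ∘ h)
  ∑-map h [] f = refl
  ∑-map h (x ∷ xs) f = cong (f (h x) +_) (∑-map h xs f)

  ∑-cartesianProduct : ∀ (xs : List A) (ys : List B) f →
    ∑ (cartesianProduct xs ys) f ≡ ∑ xs (λ x → ∑ ys (λ y → f (x , y)))
  ∑-cartesianProduct [] ys f = refl
  ∑-cartesianProduct (x ∷ xs) ys f = trans (∑-++ (map (x ,_) ys) _ f)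
    (cong₂ _+_ (∑-map (x ,_) ys f) (∑-cartesianProduct xs ys f))

  ∑-filter : ∀ {P : Pred A 0ℓ} (P? : Decidable P) xs →
    length (filter P? xs) ≡ ∑ xs (𝟙 ∘ P?)
  ∑-filter P? [] = refl
  ∑-filter P? (x ∷ xs) with does (P? x)
  ... | true = cong suc (∑-filter P? xs)
  ... | false = ∑-filter P? xs

  ∑≢0⇒∃ : ∀ (xs : List A) f → ∑ xs f ≢ 0 → ∃ λ x → f x ≢ 0
  ∑≢0⇒∃ [] f ∑≢0 = contradiction refl ∑≢0
  ∑≢0⇒∃ (x ∷ xs) f ∑≢0 with f x ℕ.≟ 0
  ... | no fx≢0 = x , fx≢0
  ... | yes fx≡0 = ∑≢0⇒∃ xs f (λ e → ∑≢0 (cong₂ _+_ fx≡0 e))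

  term≢0⇒∑≢0 : ∀ {xs : List A} {x} f → x ∈ xs → f x ≢ 0 → ∑ xs f ≢ 0
  term≢0⇒∑≢0 {xs = x ∷ xs} f (here refl) fx≢0 e = fx≢0 (ℕ.m+n≡0⇒m≡0 (f x) e)
  term≢0⇒∑≢0 {xs = y ∷ xs} f (there i) fx≢0 e = term≢0⇒∑≢0 f i fx≢0 (ℕ.m+n≡0⇒n≡0 (f y) e)

  -- `once` states completeness and absence of repetitions together, as the delta sum that exchanges
  -- of summation consume.
  record Finite (A : Set) : Set where
    infix 4 _≟_
    field
      elements : List A
      _≟_ : DecidableEquality A
      once : ∀ a → ∑ elements (λ x → 𝟙 (x ≟ a)) ≡ 1

    ∈-elements : ∀ a → a ∈ elements
    ∈-elements a = search elements (λ e → contradiction (trans (sym e) (once a)) λ ())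
      where
      search : ∀ xs → ∑ xs (λ x → 𝟙 (x ≟ a)) ≢ 0 → a ∈ xs
      search [] ∑≢0 = contradiction refl ∑≢0
      search (x ∷ xs) ∑≢0 with x ≟ a
      ... | yes x≡a = here (sym x≡a)
      ... | no _ = there (search xs ∑≢0)

    ∑-pick : ∀ a (f : A → ℕ) → ∑ elements (λ x → 𝟙 (x ≟ a) * f x) ≡ f a
    ∑-pick a f = begin
      ∑ elements (λ x → 𝟙 (x ≟ a) * f x)  ≡⟨ ∑-cong elements at-a ⟩
      ∑ elements (λ x → 𝟙 (x ≟ a) * f a)  ≡⟨ ∑-*ʳ elements _ (f a) ⟩
      ∑ elements (λ x → 𝟙 (x ≟ a)) * f a  ≡⟨ cong (_* f a) (once a) ⟩
      1 * f a                             ≡⟨ ℕ.*-identityˡ (f a) ⟩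
      f a                                 ∎
      where
      open ≡-Reasoning
      at-a : ∀ x → 𝟙 (x ≟ a) * f x ≡ 𝟙 (x ≟ a) * f a
      at-a x with x ≟ a
      ... | yes refl = refl
      ... | no _ = refl

  open Finite using (elements; once; ∈-elements; ∑-pick)

  -- Writing f (to a) as a delta sum over B and exchanging the sums leaves, for each b, a count of
  -- its preimages; `from b` is the only one.
  ∑-reindex : (FA : Finite A) (FB : Finite B) (to : A → B) (from : B → A) →
    (∀ a → from (to a) ≡ a) → (∀ b → to (from b) ≡ b) →
    ∀ f → ∑ (elements FA) (f ∘ to) ≡ ∑ (elements FB) f
  ∑-reindex FA FB to from from-to to-from f = begin
    ∑ as (λ a → f (to a))                              ≡⟨ ∑-cong as (λ a → ∑-pick FB (to a) f) ⟨
    ∑ as (λ a → ∑ bs (λ b → 𝟙 (b B.≟ to a) * f b))     ≡⟨ ∑-swap as bs _ ⟩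
    ∑ bs (λ b → ∑ as (λ a → 𝟙 (b B.≟ to a) * f b))     ≡⟨ ∑-cong bs (λ b → ∑-*ʳ as _ (f b)) ⟩
    ∑ bs (λ b → ∑ as (λ a → 𝟙 (b B.≟ to a)) * f b)
      ≡⟨ ∑-cong bs (λ b → cong (_* f b) (∑-cong as (λ a → transpose a b))) ⟩
    ∑ bs (λ b → ∑ as (λ a → 𝟙 (a A.≟ from b)) * f b)   ≡⟨ ∑-cong bs (λ b → cong (_* f b) (once FA (from b))) ⟩
    ∑ bs (λ b → 1 * f b)                               ≡⟨ ∑-cong bs (λ b → ℕ.*-identityˡ (f b)) ⟩
    ∑ bs f                                             ∎
    where
    open ≡-Reasoning
    module A = Finite FA
    module B = Finite FB
    as = elements FA
    bs = elements FB
    transpose : ∀ a b → 𝟙 (b B.≟ to a) ≡ 𝟙 (a A.≟ from b)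
    transpose a b = 𝟙-cong (b B.≟ to a) (a A.≟ from b)
      (λ { refl → sym (from-to a) }) (λ { refl → sym (to-from b) })

  ∑-allFin-suc : ∀ n (f : Fin (suc n) → ℕ) →
    ∑ (allFin (suc n)) f ≡ f 0F + ∑ (allFin n) (f ∘ Fin.suc)
  ∑-allFin-suc n f = cong (f 0F +_) (tabulate-∘ n (λ i → i))
    where
    tabulate-∘ : ∀ n {m} (h : Fin n → Fin m) {f : Fin (suc m) → ℕ} →
      ∑ (tabulate (Fin.suc ∘ h)) f ≡ ∑ (tabulate h) (f ∘ Fin.suc)
    tabulate-∘ zero h = refl
    tabulate-∘ (suc n) h {f} = cong (f (Fin.suc (h 0F)) +_) (tabulate-∘ n (h ∘ Fin.suc))

  Fin-finite : ∀ n → Finite (Fin n)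
  Fin-finite n = record { elements = allFin n ; _≟_ = Fin._≟_ ; once = once-Fin n }
    where
    once-Fin : ∀ n (a : Fin n) → ∑ (allFin n) (λ x → 𝟙 (x Fin.≟ a)) ≡ 1
    once-Fin (suc n) 0F = trans (∑-allFin-suc n (λ x → 𝟙 (x Fin.≟ 0F)))
      (cong suc (∑-zero (allFin n) (λ x → 𝟙-false (Fin.suc x Fin.≟ 0F) λ ())))
    once-Fin (suc n) (Fin.suc a) = trans (∑-allFin-suc n (λ x → 𝟙 (x Fin.≟ Fin.suc a)))
      (trans (∑-cong (allFin n) (λ x → 𝟙-cong (Fin.suc x Fin.≟ Fin.suc a) (x Fin.≟ a)
          Fin.suc-injective (cong Fin.suc)))
        (once-Fin n a))

  ∑-Fin-1 : ∀ n → ∑ (allFin n) (λ _ → 1) ≡ n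
  ∑-Fin-1 zero = refl
  ∑-Fin-1 (suc n) = trans (∑-allFin-suc n (λ _ → 1)) (cong suc (∑-Fin-1 n))

  ×-finite : Finite A → Finite B → Finite (A × B)
  ×-finite FA FB = record
    { elements = cartesianProduct (elements FA) (elements FB)
    ; _≟_ = λ p q → pair≟ p q
    ; once = λ { (a , b) → begin
        ∑ (cartesianProduct as bs) (λ p → 𝟙 (pair≟ p (a , b)))  ≡⟨ ∑-cartesianProduct as bs _ ⟩
        ∑ as (λ x → ∑ bs (λ y → 𝟙 (pair≟ (x , y) (a , b))))
          ≡⟨ ∑-cong as (λ x → trans (∑-cong bs (λ y → split x y a b)) (∑-*ˡ bs (𝟙 (x A.≟ a)) _)) ⟩
        ∑ as (λ x → 𝟙 (x A.≟ a) * ∑ bs (λ y → 𝟙 (y B.≟ b)))     ≡⟨ ∑-pick FA a (λ _ → ∑ bs (λ y → 𝟙 (y B.≟ b))) ⟩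
        ∑ bs (λ y → 𝟙 (y B.≟ b))                                ≡⟨ once FB b ⟩
        1                                                       ∎ } }
    where
    open ≡-Reasoning
    module A = Finite FA
    module B = Finite FB
    as = elements FA
    bs = elements FB
    pair≟ : DecidableEquality (_ × _)
    pair≟ = Product.≡-dec A._≟_ B._≟_
    split : ∀ x y a b → 𝟙 (pair≟ (x , y) (a , b)) ≡ 𝟙 (x A.≟ a) * 𝟙 (y B.≟ b)
    split x y a b = trans
      (𝟙-cong (pair≟ (x , y) (a , b)) (x A.≟ a ×-dec y B.≟ b)
        (λ { refl → refl , refl }) (λ { (refl , refl) → refl }))
      (𝟙-×-dec (x A.≟ a) (y B.≟ b))

  -- Divisibility of weighted sums by orbit sizes.

  module _ (FA : Finite A) where
    private E = elements FA

    -- Each class contributes m times the constant value of f on it. Everything is demanded only on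
    -- the support of f, since inversion in the field behaves well only there; reflexivity and the
    -- Euclidean law together give symmetry and transitivity.
    class-size-divides : (_~_ : A → A → Set) (_~?_ : ∀ x y → Dec (x ~ y)) → ∀ m f →
      (∀ {x} → f x ≢ 0 → x ~ x) →
      (∀ {x y} → f x ≢ 0 → x ~ y → f y ≡ f x) →
      (∀ {x y z} → f x ≢ 0 → x ~ y → x ~ z → y ~ z) →
      (∀ {x} → f x ≢ 0 → ∑ E (λ y → 𝟙 (x ~? y)) ≡ m) →
      m ∣ ∑ E f
    class-size-divides _~_ _~?_ m f = go (∑ E f) f ℕ.≤-refl
      where
      -- Removes one class of the support at a time; n bounds the remaining sum.
      go : ∀ n f → ∑ E f ≤ n →
        (∀ {x} → f x ≢ 0 → x ~ x) →
        (∀ {x y} → f x ≢ 0 → x ~ y → f y ≡ f x) →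
        (∀ {x y z} → f x ≢ 0 → x ~ y → x ~ z → y ~ z) →
        (∀ {x} → f x ≢ 0 → ∑ E (λ y → 𝟙 (x ~? y)) ≡ m) →
        m ∣ ∑ E f
      go n f ∑≤n ~-refl f-const ~-eucl size with ∑ E f ℕ.≟ 0
      ... | yes ∑≡0 = subst (m ∣_) (sym ∑≡0) (m ∣0)
      go zero f ∑≤n ~-refl f-const ~-eucl size | no ∑≢0 = contradiction (ℕ.n≤0⇒n≡0 ∑≤n) ∑≢0
      go (suc n) f ∑≤n ~-refl f-const ~-eucl size | no ∑≢0 with ∑≢0⇒∃ E f ∑≢0
      ... | a , fa≢0 = subst (m ∣_) (sym ∑-split)
              (∣m∣n⇒∣m+n (n∣m*n (f a)) (go n f′ ∑f′≤n
                (~-refl ∘ support) f′-const (~-eucl ∘ support) (size ∘ support)))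
        where
        f′ : A → ℕ
        f′ x = if does (a ~? x) then 0 else f x

        support : ∀ {x} → f′ x ≢ 0 → f x ≢ 0
        support {x} f′x≢0 with does (a ~? x)
        ... | true = contradiction refl f′x≢0
        ... | false = f′x≢0

        outside : ∀ {x} → f′ x ≢ 0 → ¬ a ~ x
        outside {x} f′x≢0 a~x with a ~? x
        ... | yes _ = f′x≢0 refl
        ... | no a≁x = a≁x a~x

        f′-const : ∀ {x y} → f′ x ≢ 0 → x ~ y → f′ y ≡ f′ x
        f′-const {x} {y} f′x≢0 x~y with a ~? y
        -- A y in the removed class, related to x, would drag x into that class too.
        ... | yes a~y = contradiction
          (~-eucl (λ e → fa≢0 (trans (sym (f-const fa≢0 a~y)) e)) y~a y~x)
          (outside {x} f′x≢0)
          where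
          y~a = ~-eucl fa≢0 a~y (~-refl fa≢0)
          y~x = ~-eucl (support {x} f′x≢0) x~y (~-refl (support {x} f′x≢0))
        ... | no _ with a ~? x
        ...   | yes _ = contradiction refl f′x≢0
        ...   | no _ = f-const f′x≢0 x~y

        pointwise : ∀ x → f x ≡ f a * 𝟙 (a ~? x) + f′ x
        pointwise x with a ~? x
        ... | yes a~x = trans (f-const fa≢0 a~x)
          (sym (trans (ℕ.+-identityʳ (f a * 1)) (ℕ.*-identityʳ (f a))))
        ... | no _ = cong (_+ f x) (sym (ℕ.*-zeroʳ (f a)))

        ∑-split : ∑ E f ≡ f a * m + ∑ E f′
        ∑-split = trans (∑-cong E pointwise) (trans (∑-+ E _ f′)
          (cong (_+ ∑ E f′) (trans (∑-*ˡ E (f a) _) (cong (f a *_) (size fa≢0)))))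

        -- The class of a contains a, so m is positive and each removal strictly lowers the sum;
        -- this is what makes the bound n decrease.
        fa*m≢0 : f a * m ≢ 0
        fa*m≢0 e = term≢0⇒∑≢0 (λ x → 𝟙 (a ~? x)) (∈-elements FA a)
          (λ 𝟙≡0 → contradiction (trans (sym (𝟙-true (a ~? a) (~-refl fa≢0))) 𝟙≡0) λ ())
          (trans (size fa≢0) m≡0)
          where
          m≡0 : m ≡ 0
          m≡0 with ℕ.m*n≡0⇒m≡0∨n≡0 (f a) e
          ... | inj₁ fa≡0 = contradiction fa≡0 fa≢0
          ... | inj₂ m≡0 = m≡0

        ∑f′≤n : ∑ E f′ ≤ n
        ∑f′≤n = ℕ.≤-pred (ℕ.≤-trans
          (ℕ.+-monoˡ-≤ (∑ E f′) (ℕ.n≢0⇒n>0 fa*m≢0))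
          (subst (_≤ suc n) ∑-split ∑≤n))

    -- The classes are the orbits, and freeness gives them m elements. The `quotient` hypothesis,
    -- that the step from one image of x to another is again a move, stands in for a group structure
    -- on `Fin m` and is the Euclidean law of the orbit relation.
    free-action-divides : ∀ m (move : Fin m → A → A) f →
      (∀ {x} → f x ≢ 0 → ∀ i → f (move i x) ≡ f x) →
      (∀ {x} → f x ≢ 0 → ∃ λ i → move i x ≡ x) →
      (∀ {x} → f x ≢ 0 → ∀ i j → ∃ λ l → move l (move i x) ≡ move j x) →
      (∀ {x} → f x ≢ 0 → ∀ i j → move i x ≡ move j x → i ≡ j) →
      m ∣ ∑ E f
    free-action-divides m move f f-inv unit quotient free =
      class-size-divides (λ x y → ∃ λ i → move i x ≡ y) (λ x y → reach x y) m f
        unit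
        (λ { fx≢0 (i , refl) → f-inv fx≢0 i })
        (λ { fx≢0 (i , refl) (j , refl) → quotient fx≢0 i j })
        (λ {x} fx≢0 → begin
          ∑ E (λ y → 𝟙 (reach x y))
            ≡⟨ ∑-cong E (λ y → unique-reach fx≢0 y) ⟩
          ∑ E (λ y → ∑ (allFin m) (λ i → 𝟙 (y ≟ move i x)))
            ≡⟨ ∑-swap E (allFin m) _ ⟩
          ∑ (allFin m) (λ i → ∑ E (λ y → 𝟙 (y ≟ move i x)))
            ≡⟨ ∑-cong (allFin m) (λ i → once FA (move i x)) ⟩
          ∑ (allFin m) (λ _ → 1)
            ≡⟨ ∑-Fin-1 m ⟩
          m ∎)
      where
      open ≡-Reasoning
      open Finite FA using (_≟_)
      reach : ∀ x y → Dec (∃ λ i → move i x ≡ y)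
      reach x y = Fin.any? (λ i → move i x ≟ y)

      unique-reach : ∀ {x} → f x ≢ 0 → ∀ y →
        𝟙 (reach x y) ≡ ∑ (allFin m) (λ i → 𝟙 (y ≟ move i x))
      unique-reach {x} fx≢0 y with reach x y
      ... | yes (i , refl) = sym (trans
        (∑-cong (allFin m) (λ j → 𝟙-cong (move i x ≟ move j x) (j Fin.≟ i)
          (λ e → free fx≢0 j i (sym e)) (λ { refl → refl })))
        (once (Fin-finite m) i))
      ... | no ¬r = sym (∑-zero (allFin m) (λ i → 𝟙-false (y ≟ move i x) (λ e → ¬r (i , sym e))))

    involution-divides : (σ : A → A) → ∀ f →
      (∀ {x} → f x ≢ 0 → f (σ x) ≡ f x) →
      (∀ {x} → f x ≢ 0 → σ (σ x) ≡ x) →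
      (∀ {x} → f x ≢ 0 → σ x ≢ x) →
      2 ∣ ∑ E f
    involution-divides σ f f-inv σσ σ-free = free-action-divides 2 move f
      (λ { fx≢0 0F → refl ; fx≢0 1F → f-inv fx≢0 })
      (λ _ → 0F , refl)
      (λ { fx≢0 0F j → j , refl
         ; fx≢0 1F 0F → 1F , σσ fx≢0
         ; fx≢0 1F 1F → 0F , refl })
      (λ { fx≢0 0F 0F _ → refl
         ; fx≢0 0F 1F e → contradiction (sym e) (σ-free fx≢0)
         ; fx≢0 1F 0F e → contradiction e (σ-free fx≢0)
         ; fx≢0 1F 1F _ → refl })
      where
      move : Fin 2 → A → A
      move 0F x = x
      move 1F x = σ x

    order-three-divides : (ρ : A → A) → ∀ f →
      (∀ {x} → f x ≢ 0 → f (ρ x) ≡ f x) →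
      (∀ {x} → f x ≢ 0 → ρ (ρ (ρ x)) ≡ x) →
      (∀ {x} → f x ≢ 0 → ρ x ≢ x) →
      3 ∣ ∑ E f
    order-three-divides ρ f f-inv ρρρ ρ-free = free-action-divides 3 move f
      (λ { fx≢0 0F → refl
         ; fx≢0 1F → f-inv fx≢0
         ; fx≢0 2F → trans (f-inv (support fx≢0)) (f-inv fx≢0) })
      (λ _ → 0F , refl)
      (λ { fx≢0 0F j → j , refl
         ; fx≢0 1F 0F → 2F , ρρρ fx≢0
         ; fx≢0 1F 1F → 0F , refl
         ; fx≢0 1F 2F → 1F , refl
         ; fx≢0 2F 0F → 1F , ρρρ fx≢0
         ; fx≢0 2F 1F → 2F , cong ρ (ρρρ fx≢0)
         ; fx≢0 2F 2F → 0F , refl })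
      (λ { fx≢0 0F 0F _ → refl
         ; fx≢0 0F 1F e → contradiction (sym e) (ρ-free fx≢0)
         ; fx≢0 0F 2F e → contradiction (trans (cong ρ e) (ρρρ fx≢0)) (ρ-free fx≢0)
         ; fx≢0 1F 0F e → contradiction e (ρ-free fx≢0)
         ; fx≢0 1F 1F _ → refl
         ; fx≢0 1F 2F e → contradiction (sym e) (ρ-free (support fx≢0))
         ; fx≢0 2F 0F e → contradiction (trans (cong ρ (sym e)) (ρρρ fx≢0)) (ρ-free fx≢0)
         ; fx≢0 2F 1F e → contradiction e (ρ-free (support fx≢0))
         ; fx≢0 2F 2F _ → refl })
      where
      move : Fin 3 → A → A
      move 0F x = x
      move 1F x = ρ x
      move 2F x = ρ (ρ x)
      support : ∀ {x} → f x ≢ 0 → f (ρ x) ≢ 0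
      support fx≢0 e = fx≢0 (trans (sym (f-inv fx≢0)) e)

    -- Every nontrivial subgroup of a cyclic group of order 4 contains its involution, so freeness
    -- need only be checked at σ².
    order-four-divides : (σ : A → A) → ∀ f →
      (∀ {x} → f x ≢ 0 → f (σ x) ≡ f x) →
      (∀ {x} → f x ≢ 0 → σ (σ (σ (σ x))) ≡ x) →
      (∀ {x} → f x ≢ 0 → σ (σ x) ≢ x) →
      4 ∣ ∑ E f
    order-four-divides σ f f-inv σ⁴ σ²-free = free-action-divides 4 move f
      (λ { s 0F → refl ; s 1F → f-inv s ; s 2F → trans (f-inv (support s)) (f-inv s)
         ; s 3F → trans (f-inv (support (support s))) (trans (f-inv (support s)) (f-inv s)) })
      (λ _ → 0F , refl)
      (λ { s 0F j → j , refl
         ; s 1F 0F → 3F , σ⁴ s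
         ; s 1F 1F → 0F , refl
         ; s 1F 2F → 1F , refl
         ; s 1F 3F → 2F , refl
         ; s 2F 0F → 2F , σ⁴ s
         ; s 2F 1F → 3F , cong σ (σ⁴ s)
         ; s 2F 2F → 0F , refl
         ; s 2F 3F → 1F , refl
         ; s 3F 0F → 1F , σ⁴ s
         ; s 3F 1F → 2F , cong σ (σ⁴ s)
         ; s 3F 2F → 3F , cong (λ y → σ (σ y)) (σ⁴ s)
         ; s 3F 3F → 0F , refl })
      (λ { s 0F 0F _ → refl ; s 1F 1F _ → refl ; s 2F 2F _ → refl ; s 3F 3F _ → refl
         ; s 0F 1F e → contradiction (sym e) (σ-free s)
         ; s 1F 0F e → contradiction e (σ-free s)
         ; s 0F 2F e → contradiction (sym e) (σ²-free s)
         ; s 2F 0F e → contradiction e (σ²-free s)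
         ; s 0F 3F e → contradiction (trans (cong σ e) (σ⁴ s)) (σ-free s)
         ; s 3F 0F e → contradiction (trans (cong σ (sym e)) (σ⁴ s)) (σ-free s)
         ; s 1F 2F e → contradiction (sym e) (σ-free (support s))
         ; s 2F 1F e → contradiction e (σ-free (support s))
         ; s 1F 3F e → contradiction (sym e) (σ²-free (support s))
         ; s 3F 1F e → contradiction e (σ²-free (support s))
         ; s 2F 3F e → contradiction (sym e) (σ-free (support (support s)))
         ; s 3F 2F e → contradiction e (σ-free (support (support s))) })
      where
      move : Fin 4 → A → A
      move 0F x = x
      move 1F x = σ x
      move 2F x = σ (σ x)
      move 3F x = σ (σ (σ x))
      support : ∀ {x} → f x ≢ 0 → f (σ x) ≢ 0
      support s e = s (trans (sym (f-inv s)) e)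
      σ-free : ∀ {x} → f x ≢ 0 → σ x ≢ x
      σ-free s e = σ²-free s (trans (cong σ e) e)

    four-group-divides : (σ τ : A → A) → ∀ f →
      (∀ {x} → f x ≢ 0 → f (σ x) ≡ f x) → (∀ {x} → f x ≢ 0 → f (τ x) ≡ f x) →
      (∀ {x} → f x ≢ 0 → σ (σ x) ≡ x) → (∀ {x} → f x ≢ 0 → τ (τ x) ≡ x) →
      (∀ {x} → f x ≢ 0 → τ (σ x) ≡ σ (τ x)) →
      (∀ {x} → f x ≢ 0 → σ x ≢ x) → (∀ {x} → f x ≢ 0 → τ x ≢ x) →
      (∀ {x} → f x ≢ 0 → σ (τ x) ≢ x) →
      4 ∣ ∑ E f
    four-group-divides σ τ f f-σ f-τ σσ ττ τσ σ-free τ-free στ-free = free-action-divides 4 move f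
      (λ { s 0F → refl ; s 1F → f-σ s ; s 2F → f-τ s ; s 3F → trans (f-σ (τ-support s)) (f-τ s) })
      (λ _ → 0F , refl)
      (λ { s 0F j → j , refl
         ; s 1F 0F → 1F , σσ s
         ; s 1F 1F → 0F , refl
         ; s 1F 2F → 3F , trans (cong σ (τσ s)) (σσ (τ-support s))
         ; s 1F 3F → 2F , τσ s
         ; s 2F 0F → 2F , ττ s
         ; s 2F 1F → 3F , cong σ (ττ s)
         ; s 2F 2F → 0F , refl
         ; s 2F 3F → 1F , refl
         ; s 3F 0F → 3F , trans (cong σ (τστ s)) (σσ s)
         ; s 3F 1F → 2F , τστ s
         ; s 3F 2F → 1F , σσ (τ-support s)
         ; s 3F 3F → 0F , refl })
      (λ { s 0F 0F _ → refl ; s 1F 1F _ → refl ; s 2F 2F _ → refl ; s 3F 3F _ → refl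
         ; s 0F 1F e → contradiction (sym e) (σ-free s)
         ; s 1F 0F e → contradiction e (σ-free s)
         ; s 0F 2F e → contradiction (sym e) (τ-free s)
         ; s 2F 0F e → contradiction e (τ-free s)
         ; s 0F 3F e → contradiction (sym e) (στ-free s)
         ; s 3F 0F e → contradiction e (στ-free s)
         ; s 1F 2F e → contradiction (trans (cong σ (sym e)) (σσ s)) (στ-free s)
         ; s 2F 1F e → contradiction (trans (cong σ e) (σσ s)) (στ-free s)
         ; s 1F 3F e → contradiction (trans (sym (σσ (τ-support s))) (trans (cong σ (sym e)) (σσ s))) (τ-free s)
         ; s 3F 1F e → contradiction (trans (sym (σσ (τ-support s))) (trans (cong σ e) (σσ s))) (τ-free s)
         ; s 2F 3F e → contradiction (sym e) (σ-free (τ-support s))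
         ; s 3F 2F e → contradiction e (σ-free (τ-support s)) })
      where
      move : Fin 4 → A → A
      move 0F x = x
      move 1F x = σ x
      move 2F x = τ x
      move 3F x = σ (τ x)
      τ-support : ∀ {x} → f x ≢ 0 → f (τ x) ≢ 0
      τ-support s e = s (trans (sym (f-τ s)) e)
      τστ : ∀ {x} → f x ≢ 0 → τ (σ (τ x)) ≡ σ x
      τστ s = trans (τσ (τ-support s)) (cong σ (ττ s))

open FiniteSums

open Finite using (elements; once; ∈-elements; ∑-pick)

-- Arithmetic in the finite field.

module Field {q : ℕ} (F : FiniteField q) where
  open FiniteField F public
    using (Carrier; _+_; _*_; -_; 0#; 1#; _⁻¹; isCommutativeRing; 0≢1; ⁻¹-inverse; enumeration)
    renaming (_≟_ to infix 4 _≟_)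

  commutativeRing : CommutativeRing 0ℓ 0ℓ
  commutativeRing = record { isCommutativeRing = isCommutativeRing }

  open CommutativeRing commutativeRing public
    using (_-_; *-comm; *-assoc; *-identityˡ; *-identityʳ; zeroˡ; zeroʳ; -‿inverseʳ; +-identityˡ)
  open IntegerCoefficients commutativeRing public
    using (solve; _:=_; :0; :1; _:+_; _:*_; _:-_; :-_)

  index : Carrier → Fin q
  index = Inverse.from enumeration

  elt-index : ∀ x → elt F (index x) ≡ x
  elt-index x = Inverse.inverseˡ enumeration refl

  index-elt : ∀ i → index (elt F i) ≡ i
  index-elt i = Inverse.inverseʳ enumeration refl

  Carrier-finite : Finite Carrier
  Carrier-finite = record
    { elements = map (elt F) (allFin q)
    ; _≟_ = _≟_
    ; once = λ a → begin
        ∑ (map (elt F) (allFin q)) (λ x → 𝟙 (x ≟ a))  ≡⟨ ∑-map (elt F) (allFin q) _ ⟩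
        ∑ (allFin q) (λ i → 𝟙 (elt F i ≟ a))
          ≡⟨ ∑-cong (allFin q) (λ i → 𝟙-cong (elt F i ≟ a) (i Fin.≟ index a)
               (λ { refl → sym (index-elt i) }) (λ { refl → elt-index a })) ⟩
        ∑ (allFin q) (λ i → 𝟙 (i Fin.≟ index a))      ≡⟨ once (Fin-finite q) (index a) ⟩
        1                                             ∎
    }
    where open ≡-Reasoning

  E : List Carrier
  E = elements Carrier-finite

  ∑-E : ∀ f → ∑ E f ≡ ∑ (allFin q) (f ∘ elt F)
  ∑-E f = ∑-map (elt F) (allFin q) f

  ∑-E-1 : ∑ E (λ _ → 1) ≡ q
  ∑-E-1 = trans (∑-E _) (∑-Fin-1 q)

  ∑-permute : (to from : Carrier → Carrier) →
    (∀ x → from (to x) ≡ x) → (∀ x → to (from x) ≡ x) →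
    ∀ f → ∑ E (f ∘ to) ≡ ∑ E f
  ∑-permute = ∑-reindex Carrier-finite Carrier-finite

  any? : {P : Carrier → Set} → (∀ x → Dec (P x)) → Dec (∃ P)
  any? {P} P? = map′ (λ { (i , p) → elt F i , p })
    (λ { (x , p) → index x , subst P (sym (elt-index x)) p })
    (Fin.any? (P? ∘ elt F))

  x-y≡0⇒x≡y : ∀ {x y} → x - y ≡ 0# → x ≡ y
  x-y≡0⇒x≡y {x} {y} e = trans
    (solve 2 (λ x y → x := (x :- y) :+ y) refl x y) (trans (cong (_+ y) e) (+-identityˡ y))

  x≡y⇒x-y≡0 : ∀ {x y} → x ≡ y → x - y ≡ 0#
  x≡y⇒x-y≡0 refl = -‿inverseʳ _

  ⁻¹-inverseˡ : ∀ {x} → x ≢ 0# → x ⁻¹ * x ≡ 1#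
  ⁻¹-inverseˡ {x} x≢0 = trans (*-comm _ _) (⁻¹-inverse x x≢0)

  *-divideˡ : ∀ {x} → x ≢ 0# → ∀ y → x ⁻¹ * (x * y) ≡ y
  *-divideˡ {x} x≢0 y = trans (sym (*-assoc _ _ _))
    (trans (cong (_* y) (⁻¹-inverseˡ x≢0)) (*-identityˡ y))

  *-divideˡ′ : ∀ {x} → x ≢ 0# → ∀ y → x * (x ⁻¹ * y) ≡ y
  *-divideˡ′ {x} x≢0 y = trans (sym (*-assoc _ _ _))
    (trans (cong (_* y) (⁻¹-inverse x x≢0)) (*-identityˡ y))

  *-cancelˡ : ∀ {x y z} → x ≢ 0# → x * y ≡ x * z → y ≡ z
  *-cancelˡ {x} {y} {z} x≢0 e =
    trans (sym (*-divideˡ x≢0 y)) (trans (cong (x ⁻¹ *_) e) (*-divideˡ x≢0 z))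

  x*y≡0⇒x≡0∨y≡0 : ∀ {x y} → x * y ≡ 0# → x ≡ 0# ⊎ y ≡ 0#
  x*y≡0⇒x≡0∨y≡0 {x} {y} e with x ≟ 0#
  ... | yes x≡0 = inj₁ x≡0
  ... | no x≢0 = inj₂ (*-cancelˡ x≢0 (trans e (sym (zeroʳ x))))

  *-≢0 : ∀ {x y} → x ≢ 0# → y ≢ 0# → x * y ≢ 0#
  *-≢0 x≢0 y≢0 e = [ x≢0 , y≢0 ]′ (x*y≡0⇒x≡0∨y≡0 e)

  *-≢0ˡ : ∀ {x y} → x * y ≢ 0# → x ≢ 0#
  *-≢0ˡ {y = y} xy≢0 refl = xy≢0 (zeroˡ y)

  *-≢0ʳ : ∀ {x y} → x * y ≢ 0# → y ≢ 0#
  *-≢0ʳ {x} xy≢0 refl = xy≢0 (zeroʳ x)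

  x*y≡1⇒x≢0 : ∀ {x y} → x * y ≡ 1# → x ≢ 0#
  x*y≡1⇒x≢0 {y = y} e refl = 0≢1 (trans (sym (zeroˡ y)) e)

  ⁻¹-≢0 : ∀ {x} → x ≢ 0# → x ⁻¹ ≢ 0#
  ⁻¹-≢0 x≢0 = x*y≡1⇒x≢0 (⁻¹-inverseˡ x≢0)

  ⁻¹-unique : ∀ {x y} → x * y ≡ 1# → y ≡ x ⁻¹
  ⁻¹-unique {x} e = *-cancelˡ x≢0 (trans e (sym (⁻¹-inverse x x≢0)))
    where x≢0 = x*y≡1⇒x≢0 e

  ⁻¹-involutive : ∀ {x} → x ≢ 0# → x ⁻¹ ⁻¹ ≡ x
  ⁻¹-involutive x≢0 = sym (⁻¹-unique (⁻¹-inverseˡ x≢0))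

  ⁻¹-1# : 1# ⁻¹ ≡ 1#
  ⁻¹-1# = sym (⁻¹-unique (*-identityˡ 1#))

  x²≡y²⇒x≡±y : ∀ {x y} → x * x ≡ y * y → x ≡ y ⊎ x ≡ - y
  x²≡y²⇒x≡±y {x} {y} e with x*y≡0⇒x≡0∨y≡0 (trans
    (solve 2 (λ x y → (x :- y) :* (x :- (:- y)) := x :* x :- y :* y) refl x y) (x≡y⇒x-y≡0 e))
  ... | inj₁ e′ = inj₁ (x-y≡0⇒x≡y e′)
  ... | inj₂ e′ = inj₂ (x-y≡0⇒x≡y e′)

  ∑-scale : ∀ {c} → c ≢ 0# → ∀ f → ∑ E (λ x → f (c * x)) ≡ ∑ E f
  ∑-scale {c} c≢0 = ∑-permute (c *_) (c ⁻¹ *_) (*-divideˡ c≢0) (*-divideˡ′ c≢0)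

  -- Multiplicative subgroups and the squares in them.

  record Subgroup : Set₁ where
    field
      Member : Carrier → Set
      member? : ∀ x → Dec (Member x)
      0∉ : ∀ {x} → Member x → x ≢ 0#
      1∈ : Member 1#
      *-closed : ∀ {x y} → Member x → Member y → Member (x * y)
      ⁻¹-closed : ∀ {x} → Member x → Member (x ⁻¹)

    order : ℕ
    order = ∑ E (λ x → 𝟙 (member? x))

    order≢0 : order ≢ 0
    order≢0 = term≢0⇒∑≢0 _ (∈-elements Carrier-finite 1#)
      (λ e → contradiction (trans (sym (𝟙-true (member? 1#) 1∈)) e) λ ())

    coset-size : ∀ {c} → c ≢ 0# → ∑ E (λ x → 𝟙 (member? (c * x))) ≡ order
    coset-size c≢0 = ∑-scale c≢0 (λ x → 𝟙 (member? x))

    cancelˡ : ∀ {x y} → Member x → Member (x * y) → Member y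
    cancelˡ {x} {y} x∈ xy∈ = subst Member (*-divideˡ (0∉ x∈) y) (*-closed (⁻¹-closed x∈) xy∈)

    -- If no x outside the subgroup had its square inside, then the classes
    -- xH ∪ x⁻¹H outside H would all have exactly 2|H| elements.
    ∃-square-root-outside : 2 ℕ.* order ∣ q ∸ 1 →
      ∃ λ x → x ≢ 0# × ¬ Member x × Member (x * x)
    ∃-square-root-outside 2h∣q-1
      with any? (λ x → ¬? (x ≟ 0#) ×-dec ¬? (member? x) ×-dec member? (x * x))
    ... | yes found = found
    ... | no none = contradiction (∣⇒≤ ⦃ ℕ.≢-nonZero order≢0 ⦄ 2h∣h) (ℕ.<⇒≱ h<2h)
      where
      open ≡-Reasoning
      outside? : ∀ x → Dec (x ≢ 0# × ¬ Member x)
      outside? x = ¬? (x ≟ 0#) ×-dec ¬? (member? x)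

      f : Carrier → ℕ
      f x = 𝟙 (outside? x)

      _~_ : Carrier → Carrier → Set
      x ~ y = Member (x ⁻¹ * y) ⊎ Member (x * y)

      _~?_ : ∀ x y → Dec (x ~ y)
      x ~? y = member? (x ⁻¹ * y) ⊎-dec member? (x * y)

      outside-~ : ∀ {x y} → x ≢ 0# × ¬ Member x → x ~ y → y ≢ 0# × ¬ Member y
      outside-~ {x} {y} (x≢0 , x∉) (inj₁ y/x∈) =
        *-≢0ʳ (0∉ y/x∈) ,
        λ y∈ → x∉ (subst Member (⁻¹-involutive x≢0)
          (⁻¹-closed (cancelˡ y∈ (subst Member (*-comm _ _) y/x∈))))
      outside-~ {x} {y} (x≢0 , x∉) (inj₂ xy∈) =
        *-≢0ʳ (0∉ xy∈) ,
        λ y∈ → x∉ (cancelˡ y∈ (subst Member (*-comm _ _) xy∈))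

      ~-eucl : ∀ {x y z} → x ≢ 0# → x ~ y → x ~ z → y ~ z
      ~-eucl {x} {y} {z} x≢0 (inj₁ y/x∈) (inj₁ z/x∈) =
        inj₁ (cancelˡ y/x∈ (subst Member (sym e) z/x∈))
        where
        y≢0 = *-≢0ʳ (0∉ y/x∈)
        e : x ⁻¹ * y * (y ⁻¹ * z) ≡ x ⁻¹ * z
        e = trans (*-assoc _ _ _) (cong (x ⁻¹ *_) (*-divideˡ′ y≢0 z))
      ~-eucl {x} {y} {z} x≢0 (inj₁ y/x∈) (inj₂ xz∈) =
        inj₂ (subst Member e (*-closed y/x∈ xz∈))
        where
        e : x ⁻¹ * y * (x * z) ≡ y * z
        e = trans (solve 4 (λ a b c d → a :* b :* (c :* d) := (a :* c) :* (b :* d)) refl (x ⁻¹) y x z)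
          (trans (cong (_* (y * z)) (⁻¹-inverseˡ x≢0)) (*-identityˡ _))
      ~-eucl {x} {y} {z} x≢0 (inj₂ xy∈) (inj₁ z/x∈) =
        inj₂ (subst Member e (*-closed xy∈ z/x∈))
        where
        e : x * y * (x ⁻¹ * z) ≡ y * z
        e = trans (solve 4 (λ a b c d → a :* b :* (c :* d) := (a :* c) :* (b :* d)) refl x y (x ⁻¹) z)
          (trans (cong (_* (y * z)) (⁻¹-inverse x x≢0)) (*-identityˡ _))
      ~-eucl {x} {y} {z} x≢0 (inj₂ xy∈) (inj₂ xz∈) =
        inj₁ (cancelˡ xy∈ (subst Member (sym e) xz∈))
        where
        y≢0 = *-≢0ʳ (0∉ xy∈)
        e : x * y * (y ⁻¹ * z) ≡ x * z
        e = trans (*-assoc _ _ _) (cong (x *_) (*-divideˡ′ y≢0 z))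

      -- If xH and x⁻¹H met, x² would lie in H, and x would be the element assumed not to exist.
      disjoint : ∀ {x} → x ≢ 0# × ¬ Member x → ∀ y →
        𝟙 (x ~? y) ≡ 𝟙 (member? (x ⁻¹ * y)) ℕ.+ 𝟙 (member? (x * y))
      disjoint {x} (x≢0 , x∉) y with member? (x ⁻¹ * y) | member? (x * y)
      ... | yes y/x∈ | yes xy∈ = contradiction
        (x , x≢0 , x∉ , cancelˡ y/x∈ (subst Member (sym e) xy∈)) none
        where
        e : x ⁻¹ * y * (x * x) ≡ x * y
        e = trans (solve 3 (λ a b c → a :* b :* (c :* c) := (a :* c) :* (c :* b)) refl (x ⁻¹) y x)
          (trans (cong (_* (x * y)) (⁻¹-inverseˡ x≢0)) (*-identityˡ _))
      ... | yes _ | no _ = refl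
      ... | no _ | yes _ = refl
      ... | no _ | no _ = refl

      2h∣∑f : 2 ℕ.* order ∣ ∑ E f
      2h∣∑f = class-size-divides Carrier-finite _~_ _~?_ (2 ℕ.* order) f
        (λ {x} fx≢0 → let (x≢0 , _) = 𝟙-holds (outside? x) fx≢0 in
          inj₁ (subst Member (sym (⁻¹-inverseˡ x≢0)) 1∈))
        (λ {x} {y} fx≢0 x~y → let out = 𝟙-holds (outside? x) fx≢0 in
          trans (𝟙-true (outside? y) (outside-~ out x~y)) (sym (𝟙-true (outside? x) out)))
        (λ {x} fx≢0 → ~-eucl (proj₁ (𝟙-holds (outside? x) fx≢0)))
        (λ {x} fx≢0 → let out = 𝟙-holds (outside? x) fx≢0 in begin
          ∑ E (λ y → 𝟙 (x ~? y))                                           ≡⟨ ∑-cong E (disjoint out) ⟩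
          ∑ E (λ y → 𝟙 (member? (x ⁻¹ * y)) ℕ.+ 𝟙 (member? (x * y)))       ≡⟨ ∑-+ E _ _ ⟩
          ∑ E (λ y → 𝟙 (member? (x ⁻¹ * y))) ℕ.+ ∑ E (λ y → 𝟙 (member? (x * y)))
            ≡⟨ cong₂ ℕ._+_ (coset-size (⁻¹-≢0 (proj₁ out))) (coset-size (proj₁ out)) ⟩
          order ℕ.+ order                                                  ≡⟨ cong (order ℕ.+_) (ℕ.+-identityʳ order) ⟨
          2 ℕ.* order                                                      ∎)

      partition : ∀ x → 1 ≡ 𝟙 (x ≟ 0#) ℕ.+ (f x ℕ.+ 𝟙 (member? x))
      partition x with x ≟ 0# | member? x
      ... | yes x≡0 | yes x∈ = contradiction x≡0 (0∉ x∈)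
      ... | yes _ | no _ = refl
      ... | no _ | yes _ = refl
      ... | no _ | no _ = refl

      q≡ : q ≡ 1 ℕ.+ (∑ E f ℕ.+ order)
      q≡ = begin
        q                                                         ≡⟨ ∑-E-1 ⟨
        ∑ E (λ _ → 1)                                             ≡⟨ ∑-cong E partition ⟩
        ∑ E (λ x → 𝟙 (x ≟ 0#) ℕ.+ (f x ℕ.+ 𝟙 (member? x)))        ≡⟨ ∑-+ E _ _ ⟩
        ∑ E (λ x → 𝟙 (x ≟ 0#)) ℕ.+ ∑ E (λ x → f x ℕ.+ 𝟙 (member? x))
          ≡⟨ cong₂ ℕ._+_ (once Carrier-finite 0#) (∑-+ E f _) ⟩
        1 ℕ.+ (∑ E f ℕ.+ order)                                   ∎

      -- The q - 1 nonzero elements are those of H and those outside; 2h divides the whole and the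
      -- outside part, hence also the remaining h.
      2h∣h : 2 ℕ.* order ∣ order
      2h∣h = ∣m+n∣m⇒∣n (subst (2 ℕ.* order ∣_) (cong (_∸ 1) q≡) 2h∣q-1) 2h∣∑f

      h<2h : order < 2 ℕ.* order
      h<2h = subst (order <_) (ℕ.*-comm order 2)
        (ℕ.m<m*n order 2 ⦃ ℕ.≢-nonZero order≢0 ⦄ (s≤s (s≤s z≤n)))

  roots : Carrier → ℕ
  roots z = ∑ E (λ y → 𝟙 (z ≟ y * y))

  -- Elements are grouped by their square, so each z is counted once per root.
  ∑-square : ∀ f → ∑ E (λ y → f (y * y)) ≡ ∑ E (λ z → f z ℕ.* roots z)
  ∑-square f = begin
    ∑ E (λ y → f (y * y))                              ≡⟨ ∑-cong E (λ y → ∑-pick Carrier-finite (y * y) f) ⟨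
    ∑ E (λ y → ∑ E (λ z → 𝟙 (z ≟ y * y) ℕ.* f z))      ≡⟨ ∑-swap E E _ ⟩
    ∑ E (λ z → ∑ E (λ y → 𝟙 (z ≟ y * y) ℕ.* f z))      ≡⟨ ∑-cong E (λ z → trans (∑-*ʳ E _ (f z)) (ℕ.*-comm _ (f z))) ⟩
    ∑ E (λ z → f z ℕ.* roots z)                        ∎
    where open ≡-Reasoning

  -- Two roots differ at most by sign. Only a bound is claimed, since r and -r may coincide at this
  -- stage.
  roots≤2 : ∀ z → roots z ≤ 2
  roots≤2 z with any? (λ r → z ≟ r * r)
  ... | no none = subst (_≤ 2) (sym (∑-zero E (λ y → 𝟙-false (z ≟ y * y) (λ e → none (y , e))))) z≤n
  ... | yes (r , refl) = begin
    ∑ E (λ y → 𝟙 (r * r ≟ y * y))                ≤⟨ ∑-mono E pointwise ⟩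
    ∑ E (λ y → 𝟙 (y ≟ r) ℕ.+ 𝟙 (y ≟ - r))        ≡⟨ ∑-+ E _ _ ⟩
    ∑ E (λ y → 𝟙 (y ≟ r)) ℕ.+ ∑ E (λ y → 𝟙 (y ≟ - r))
      ≡⟨ cong₂ ℕ._+_ (once Carrier-finite r) (once Carrier-finite (- r)) ⟩
    2                                            ∎
    where
    open ℕ.≤-Reasoning
    pointwise : ∀ y → 𝟙 (r * r ≟ y * y) ≤ 𝟙 (y ≟ r) ℕ.+ 𝟙 (y ≟ - r)
    pointwise y with r * r ≟ y * y
    ... | no _ = z≤n
    ... | yes e with x²≡y²⇒x≡±y (sym e)
    ...   | inj₁ y≡r = ℕ.≤-trans (ℕ.≤-reflexive (sym (𝟙-true (y ≟ r) y≡r))) (ℕ.m≤m+n _ _)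
    ...   | inj₂ y≡-r = ℕ.≤-trans (ℕ.≤-reflexive (sym (𝟙-true (y ≟ - r) y≡-r))) (ℕ.m≤n+m _ (𝟙 (y ≟ r)))

  IsSquare : Carrier → Set
  IsSquare x = ∃ λ y → x ≡ y * y

  abstract
    -- Sealed, so that a decision never unfolds into a search through the field.
    isSquare? : ∀ x → Dec (IsSquare x)
    isSquare? x = any? (λ y → x ≟ y * y)

  roots≢0⇒square : ∀ {z} → roots z ≢ 0 → IsSquare z
  roots≢0⇒square {z} ≢0 with ∑≢0⇒∃ E _ ≢0
  ... | y , y≢0 = y , 𝟙-holds (z ≟ y * y) y≢0

  module _ (H : Subgroup) where
    open Subgroup H

    -- For x outside H with x² in H, the 2h elements of H ∪ xH all square into H. No element has
    -- more than two roots, so each of the h members must have exactly two.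
    small-subgroup-square : 2 ℕ.* order ∣ q ∸ 1 → ∀ {z} → Member z → IsSquare z
    small-subgroup-square 2h∣q-1 {z} z∈ with ∃-square-root-outside 2h∣q-1
    ... | x , x≢0 , x∉ , x²∈ = roots≢0⇒square (λ roots≡0 → contradiction (trans
          (sym (trans (cong (𝟙 (member? z) ℕ.*_) roots≡0) (ℕ.*-zeroʳ (𝟙 (member? z)))))
          (trans all-roots (cong (ℕ._* 2) (𝟙-true (member? z) z∈)))) λ ())
      where
      open ℕ.≤-Reasoning
      pointwise : ∀ y → 𝟙 (member? y) ℕ.+ 𝟙 (member? (x ⁻¹ * y)) ≤ 𝟙 (member? (y * y))
      pointwise y with member? y | member? (x ⁻¹ * y)
      ... | no _ | no _ = z≤n
      ... | yes y∈ | no _ = ℕ.≤-reflexive (sym (𝟙-true (member? (y * y)) (*-closed y∈ y∈)))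
      ... | no _ | yes y/x∈ = ℕ.≤-reflexive (sym (𝟙-true (member? (y * y))
        (subst Member e (*-closed (*-closed y/x∈ y/x∈) x²∈))))
        where
        e : x ⁻¹ * y * (x ⁻¹ * y) * (x * x) ≡ y * y
        e = trans (solve 3 (λ a b c → a :* b :* (a :* b) :* (c :* c) := (a :* c) :* (a :* c) :* (b :* b)) refl (x ⁻¹) y x)
          (trans (cong (λ u → u * u * (y * y)) (⁻¹-inverseˡ x≢0))
            (solve 1 (λ b → :1 :* :1 :* b := b) refl (y * y)))
      ... | yes y∈ | yes y/x∈ = contradiction
        (subst Member (⁻¹-involutive x≢0) (⁻¹-closed (cancelˡ y∈ (subst Member (*-comm _ _) y/x∈)))) x∉

      2h≤ : ∑ E (λ z → 𝟙 (member? z) ℕ.* 2) ≤ ∑ E (λ z → 𝟙 (member? z) ℕ.* roots z)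
      2h≤ = begin
        ∑ E (λ z → 𝟙 (member? z) ℕ.* 2)                              ≡⟨ ∑-*ʳ E _ 2 ⟩
        order ℕ.* 2                                                  ≡⟨ ℕ.*-comm order 2 ⟩
        order ℕ.+ (order ℕ.+ 0)                                      ≡⟨ cong (order ℕ.+_) (ℕ.+-identityʳ order) ⟩
        order ℕ.+ order                                              ≡⟨ cong (order ℕ.+_) (coset-size (⁻¹-≢0 x≢0)) ⟨
        order ℕ.+ ∑ E (λ y → 𝟙 (member? (x ⁻¹ * y)))                 ≡⟨ ∑-+ E _ _ ⟨
        ∑ E (λ y → 𝟙 (member? y) ℕ.+ 𝟙 (member? (x ⁻¹ * y)))         ≤⟨ ∑-mono E pointwise ⟩
        ∑ E (λ y → 𝟙 (member? (y * y)))                              ≡⟨ ∑-square (λ z → 𝟙 (member? z)) ⟩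
        ∑ E (λ z → 𝟙 (member? z) ℕ.* roots z)                        ∎

      all-roots : 𝟙 (member? z) ℕ.* roots z ≡ 𝟙 (member? z) ℕ.* 2
      all-roots = ∑-rigid (λ z → ℕ.*-monoʳ-≤ (𝟙 (member? z)) (roots≤2 z)) 2h≤ (∈-elements Carrier-finite z)

-- Residues and nonresidues when q ≡ 1 (mod 4).

%≡suc⇒∣∸ : ∀ {r} q n .⦃ _ : ℕ.NonZero n ⦄ → q % n ≡ suc r → n ∣ q ∸ suc r
%≡suc⇒∣∸ {r} q n e = divides (q / n) (begin
  q ∸ suc r                      ≡⟨ cong (_∸ suc r) (m≡m%n+[m/n]*n q n) ⟩
  q % n ℕ.+ q / n ℕ.* n ∸ suc r  ≡⟨ cong (λ k → k ℕ.+ q / n ℕ.* n ∸ suc r) e ⟩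
  suc r ℕ.+ q / n ℕ.* n ∸ suc r  ≡⟨ ℕ.m+n∸m≡n (suc r) _ ⟩
  q / n ℕ.* n                    ∎)
  where open ≡-Reasoning

module SquareClasses {q : ℕ} (F : FiniteField q) (q%4≡1 : q % 4 ≡ 1) where
  open Field F public

  4∣q-1 : 4 ∣ q ∸ 1
  4∣q-1 = %≡suc⇒∣∸ q 4 q%4≡1

  2∤q : ¬ 2 ∣ q
  2∤q 2∣q = contradiction (∣1⇒≡1 (∣m+n∣m⇒∣n
      (subst (2 ∣_) q≡ 2∣q) (∣-trans (divides 2 refl) 4∣q-1))) λ ()
    where
    q≡ : q ≡ q ∸ 1 ℕ.+ 1
    q≡ = sym (ℕ.m∸n+n≡m (ℕ.n≢0⇒n>0 λ { refl → contradiction q%4≡1 λ () }))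

  -- Otherwise translation by 1 would be an involution without fixed points, pairing off the field
  -- and making q even.
  -1≢1 : - 1# ≢ 1#
  -1≢1 -1≡1 = 2∤q (subst (2 ∣_) ∑-E-1 (involution-divides Carrier-finite (_+ 1#) (λ _ → 1)
    (λ _ → refl)
    (λ {x} _ → trans (solve 1 (λ x → x :+ :1 :+ :1 := x :+ (:1 :- (:- :1))) refl x)
      (trans (cong (x +_) (x≡y⇒x-y≡0 (sym -1≡1))) (solve 1 (λ x → x :+ :0 := x) refl x)))
    (λ {x} _ e → 0≢1 (sym (trans
      (solve 1 (λ x → :1 := (x :+ :1) :- x) refl x) (x≡y⇒x-y≡0 e))))))

  -x≢x : ∀ {x} → x ≢ 0# → - x ≢ x
  -x≢x {x} x≢0 e = -1≢1 (*-cancelˡ x≢0 (trans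
    (solve 1 (λ x → x :* (:- :1) := :- x) refl x) (trans e (sym (*-identityʳ x)))))

  roots-square : ∀ {z} → z ≢ 0# → IsSquare z → roots z ≡ 2
  roots-square z≢0 (r , refl) = begin
    ∑ E (λ y → 𝟙 (r * r ≟ y * y))                ≡⟨ ∑-cong E pointwise ⟩
    ∑ E (λ y → 𝟙 (y ≟ r) ℕ.+ 𝟙 (y ≟ - r))        ≡⟨ ∑-+ E _ _ ⟩
    ∑ E (λ y → 𝟙 (y ≟ r)) ℕ.+ ∑ E (λ y → 𝟙 (y ≟ - r))
      ≡⟨ cong₂ ℕ._+_ (once Carrier-finite r) (once Carrier-finite (- r)) ⟩
    2                                            ∎
    where
    open ≡-Reasoning
    pointwise : ∀ y → 𝟙 (r * r ≟ y * y) ≡ 𝟙 (y ≟ r) ℕ.+ 𝟙 (y ≟ - r)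
    pointwise y with y ≟ r | y ≟ - r
    ... | yes refl | yes e = contradiction (sym e) (-x≢x (*-≢0ˡ z≢0))
    ... | yes refl | no _ = 𝟙-true (r * r ≟ r * r) refl
    ... | no _ | yes refl = 𝟙-true (r * r ≟ - r * - r)
      (solve 1 (λ r → r :* r := (:- r) :* (:- r)) refl r)
    ... | no y≢r | no y≢-r = 𝟙-false (r * r ≟ y * y)
      (λ e → [ y≢r , y≢-r ]′ (x²≡y²⇒x≡±y (sym e)))

  residue? : ∀ x → Dec (x ≢ 0# × IsSquare x)
  residue? x = ¬? (x ≟ 0#) ×-dec isSquare? x

  nonresidue? : ∀ x → Dec (x ≢ 0# × ¬ IsSquare x)
  nonresidue? x = ¬? (x ≟ 0#) ×-dec ¬? (isSquare? x)

  -- Zero is put in neither class, so a triple with coinciding points has weight 0 in both.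
  residue nonresidue : Carrier → ℕ
  residue x = 𝟙 (residue? x)
  nonresidue x = 𝟙 (nonresidue? x)

  residue+nonresidue : ∀ x → residue x ℕ.+ nonresidue x ≡ 𝟙 (¬? (x ≟ 0#))
  residue+nonresidue x with x ≟ 0# | isSquare? x
  ... | yes _ | _ = refl
  ... | no _ | yes _ = refl
  ... | no _ | no _ = refl

  -- Squaring is two-to-one from the nonzero elements onto the residues, so twice the residues are
  -- all the nonzero elements, that is, residues and nonresidues together.
  ∑-residue≡∑-nonresidue : ∑ E residue ≡ ∑ E nonresidue
  ∑-residue≡∑-nonresidue = ℕ.+-cancelˡ-≡ (∑ E residue) _ _ (begin
    ∑ E residue ℕ.+ ∑ E residue                    ≡⟨ ∑-+ E residue residue ⟨
    ∑ E (λ z → residue z ℕ.+ residue z)            ≡⟨ ∑-cong E count ⟩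
    ∑ E (λ z → 𝟙 (¬? (z ≟ 0#)) ℕ.* roots z)        ≡⟨ ∑-square (λ z → 𝟙 (¬? (z ≟ 0#))) ⟨
    ∑ E (λ y → 𝟙 (¬? (y * y ≟ 0#)))                ≡⟨ ∑-cong E square≢0 ⟩
    ∑ E (λ y → 𝟙 (¬? (y ≟ 0#)))                    ≡⟨ ∑-cong E residue+nonresidue ⟨
    ∑ E (λ y → residue y ℕ.+ nonresidue y)         ≡⟨ ∑-+ E residue nonresidue ⟩
    ∑ E residue ℕ.+ ∑ E nonresidue                 ∎)
    where
    open ≡-Reasoning
    square≢0 : ∀ y → 𝟙 (¬? (y * y ≟ 0#)) ≡ 𝟙 (¬? (y ≟ 0#))
    square≢0 y = 𝟙-cong (¬? (y * y ≟ 0#)) (¬? (y ≟ 0#)) *-≢0ˡ (λ y≢0 → *-≢0 y≢0 y≢0)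

    count : ∀ z → residue z ℕ.+ residue z ≡ 𝟙 (¬? (z ≟ 0#)) ℕ.* roots z
    count z with z ≟ 0# | isSquare? z
    ... | yes _ | _ = refl
    ... | no z≢0 | yes sq = sym (trans (ℕ.+-identityʳ (roots z)) (roots-square z≢0 sq))
    ... | no z≢0 | no ¬sq = sym (trans (ℕ.+-identityʳ (roots z))
      (∑-zero E (λ y → 𝟙-false (z ≟ y * y) (λ e → ¬sq (y , e)))))

  abstract
    -- The residue 1 makes the residues nonempty, hence also the equally numerous nonresidues.
    ∃-nonresidue : ∃ λ η → η ≢ 0# × ¬ IsSquare η
    ∃-nonresidue with ∑≢0⇒∃ E nonresidue (λ e → term≢0⇒∑≢0 residue (∈-elements Carrier-finite 1#)
      (λ e′ → contradiction (trans (sym (𝟙-true (residue? 1#)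
        ((λ e″ → 0≢1 (sym e″)) , (1# , sym (*-identityˡ 1#))))) e′) λ ())
      (trans ∑-residue≡∑-nonresidue e))
    ... | η , ≢0 = η , 𝟙-holds (nonresidue? η) ≢0

  η : Carrier
  η = proj₁ ∃-nonresidue

  η≢0 : η ≢ 0#
  η≢0 = proj₁ (proj₂ ∃-nonresidue)

  -- Multiplication by η maps residues into nonresidues; both sets have the
  -- same size, so every nonresidue is reached.
  nonresidue-η* : ∀ x → nonresidue (η * x) ≡ residue x
  nonresidue-η* x = sym (∑-rigid residue≤
    (ℕ.≤-reflexive (trans (∑-scale η≢0 nonresidue) (sym ∑-residue≡∑-nonresidue)))
    (∈-elements Carrier-finite x))
    where
    residue≤ : ∀ x → residue x ≤ nonresidue (η * x)
    residue≤ x = 𝟙-mono (residue? x) (nonresidue? (η * x)) (λ { (x≢0 , (s , refl)) →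
      *-≢0 η≢0 x≢0 , λ (t , e) → proj₂ (proj₂ ∃-nonresidue) (t * s ⁻¹ , root x≢0 t e) })
      where
      root : ∀ {s} → s * s ≢ 0# → ∀ t → η * (s * s) ≡ t * t → η ≡ t * s ⁻¹ * (t * s ⁻¹)
      root {s} s²≢0 t e = begin
        η                                      ≡⟨ solve 1 (λ η → η := η :* (:1 :* :1)) refl η ⟩
        η * (1# * 1#)                          ≡⟨ cong (λ u → η * (u * u)) (⁻¹-inverse s (*-≢0ˡ s²≢0)) ⟨
        η * (s * s ⁻¹ * (s * s ⁻¹))            ≡⟨ solve 3 (λ η s s′ → η :* (s :* s′ :* (s :* s′)) := η :* (s :* s) :* (s′ :* s′)) refl η s (s ⁻¹) ⟩
        η * (s * s) * (s ⁻¹ * s ⁻¹)            ≡⟨ cong (_* (s ⁻¹ * s ⁻¹)) e ⟩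
        t * t * (s ⁻¹ * s ⁻¹)                  ≡⟨ solve 2 (λ t s′ → t :* t :* (s′ :* s′) := t :* s′ :* (t :* s′)) refl t (s ⁻¹) ⟩
        t * s ⁻¹ * (t * s ⁻¹)                  ∎
        where open ≡-Reasoning

  residue-η* : ∀ x → residue (η * x) ≡ nonresidue x
  residue-η* x = ℕ.+-cancelʳ-≡ (nonresidue (η * x)) _ _ (begin
    residue (η * x) ℕ.+ nonresidue (η * x)  ≡⟨ residue+nonresidue (η * x) ⟩
    𝟙 (¬? (η * x ≟ 0#))                     ≡⟨ 𝟙-cong (¬? (η * x ≟ 0#)) (¬? (x ≟ 0#)) *-≢0ʳ (*-≢0 η≢0) ⟩
    𝟙 (¬? (x ≟ 0#))                         ≡⟨ residue+nonresidue x ⟨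
    residue x ℕ.+ nonresidue x              ≡⟨ ℕ.+-comm (residue x) _ ⟩
    nonresidue x ℕ.+ residue x              ≡⟨ cong (nonresidue x ℕ.+_) (nonresidue-η* x) ⟨
    nonresidue x ℕ.+ nonresidue (η * x)     ∎)
    where open ≡-Reasoning

  -- The two properties through which every later argument sees a class, so that each argument
  -- serves residues and nonresidues alike.
  record SquareClassFunction (w : Carrier → ℕ) : Set where
    field
      at-0 : w 0# ≡ 0
      square-* : ∀ {s} → s ≢ 0# → ∀ x → w (s * s * x) ≡ w x

    ≢0 : ∀ {x} → w x ≢ 0 → x ≢ 0#
    ≢0 wx≢0 refl = wx≢0 at-0

    w-square : ∀ {a x y} → a ≢ 0# → IsSquare a → a * x ≡ y → w y ≡ w x
    w-square {x = x} a≢0 (s , refl) refl = square-* (*-≢0ˡ a≢0) x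

  open SquareClassFunction public

  square-*-square : ∀ {s x} → s ≢ 0# → IsSquare (s * s * x) → IsSquare x
  square-*-square {s} {x} s≢0 (t , e) = s ⁻¹ * t , *-cancelˡ (*-≢0 s≢0 s≢0) (begin
    s * s * x                          ≡⟨ e ⟩
    t * t                              ≡⟨ cong₂ _*_ (*-divideˡ′ s≢0 t) (*-divideˡ′ s≢0 t) ⟨
    s * (s ⁻¹ * t) * (s * (s ⁻¹ * t))  ≡⟨ solve 2 (λ s u → s :* u :* (s :* u) := s :* s :* (u :* u)) refl s (s ⁻¹ * t) ⟩
    s * s * (s ⁻¹ * t * (s ⁻¹ * t))    ∎)
    where open ≡-Reasoning

  square-square-* : ∀ {s x} → IsSquare x → IsSquare (s * s * x)
  square-square-* {s} (t , refl) = s * t ,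
    solve 2 (λ s t → s :* s :* (t :* t) := s :* t :* (s :* t)) refl s t

  residue-class : SquareClassFunction residue
  residue-class = record
    { at-0 = 𝟙-false (residue? 0#) (λ (0≢0 , _) → 0≢0 refl)
    ; square-* = λ {s} s≢0 x → 𝟙-cong (residue? (s * s * x)) (residue? x)
        (λ (≢0 , sq) → *-≢0ʳ ≢0 , square-*-square s≢0 sq)
        (λ (x≢0 , sq) → *-≢0 (*-≢0 s≢0 s≢0) x≢0 , square-square-* sq)
    }

  nonresidue-class : SquareClassFunction nonresidue
  nonresidue-class = record
    { at-0 = 𝟙-false (nonresidue? 0#) (λ (0≢0 , _) → 0≢0 refl)
    ; square-* = λ {s} s≢0 x → 𝟙-cong (nonresidue? (s * s * x)) (nonresidue? x)
        (λ (≢0 , ¬sq) → *-≢0ʳ ≢0 , ¬sq ∘ square-square-*)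
        (λ (x≢0 , ¬sq) → *-≢0 (*-≢0 s≢0 s≢0) x≢0 , ¬sq ∘ square-*-square s≢0)
    }

  -1≢0 : - 1# ≢ 0#
  -1≢0 e = 0≢1 (trans (solve 0 (:0 := :- :0) refl)
    (trans (cong -_ (sym e)) (solve 0 (:- (:- :1) := :1) refl)))

  ±1 : Subgroup
  ±1 = record
    { Member = λ x → x ≡ 1# ⊎ x ≡ - 1#
    ; member? = λ x → x ≟ 1# ⊎-dec x ≟ - 1#
    ; 0∉ = λ { (inj₁ refl) e → 0≢1 (sym e) ; (inj₂ refl) → -1≢0 }
    ; 1∈ = inj₁ refl
    ; *-closed = λ
        { (inj₁ refl) (inj₁ refl) → inj₁ (*-identityˡ _)
        ; (inj₁ refl) (inj₂ refl) → inj₂ (*-identityˡ _)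
        ; (inj₂ refl) (inj₁ refl) → inj₂ (*-identityʳ _)
        ; (inj₂ refl) (inj₂ refl) → inj₁ -1*-1 }
    ; ⁻¹-closed = λ
        { (inj₁ refl) → inj₁ ⁻¹-1#
        ; (inj₂ refl) → inj₂ (sym (⁻¹-unique -1*-1)) }
    }
    where
    -1*-1 : - 1# * - 1# ≡ 1#
    -1*-1 = solve 0 ((:- :1) :* (:- :1) := :1) refl

  ±1-order : Subgroup.order ±1 ≡ 2
  ±1-order = trans (∑-cong E pointwise) (trans (∑-+ E _ _)
    (cong₂ ℕ._+_ (once Carrier-finite 1#) (once Carrier-finite (- 1#))))
    where
    pointwise : ∀ x → 𝟙 (x ≟ 1# ⊎-dec x ≟ - 1#) ≡ 𝟙 (x ≟ 1#) ℕ.+ 𝟙 (x ≟ - 1#)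
    pointwise x with x ≟ 1# | x ≟ - 1#
    ... | yes refl | yes e = contradiction (sym e) -1≢1
    ... | yes _ | no _ = refl
    ... | no _ | yes _ = refl
    ... | no _ | no _ = refl

  -- The count for small subgroups applies to {1, -1} because 2 · 2 divides q - 1.
  -1-square : IsSquare (- 1#)
  -1-square = small-subgroup-square ±1
    (subst (λ h → 2 ℕ.* h ∣ q ∸ 1) (sym ±1-order) 4∣q-1) (inj₂ refl)

  w-neg : ∀ {w} → SquareClassFunction w → ∀ x → w (- x) ≡ w x
  w-neg W x = w-square W -1≢0 -1-square (solve 1 (λ x → (:- :1) :* x := :- x) refl x)

  -- The Vandermonde product up to sign: the value of the projective `Δ` of three finite points,
  -- written without the homogeneous coordinates.
  D : Carrier → Carrier → Carrier → Carrier
  D x y z = (x - y) * (y - z) * (z - x)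

-- Three-element subsets as test sets of a design.

∣p∣≡∑ : ∀ {n} (p : Subset n) → ∣ p ∣ ≡ ∑ (allFin n) (λ i → 𝟙 (i ∈? p))
∣p∣≡∑ [] = refl
∣p∣≡∑ {suc n} (true ∷ p) = trans (cong suc (∣p∣≡∑ p)) (sym (∑-allFin-suc n (λ i → 𝟙 (i ∈? (true ∷ p)))))
∣p∣≡∑ {suc n} (false ∷ p) = trans (∣p∣≡∑ p) (sym (∑-allFin-suc n (λ i → 𝟙 (i ∈? (false ∷ p)))))

triple : ∀ {n} → Fin n → Fin n → Fin n → Subset n
triple i j l = ⁅ i ⁆ ∪ (⁅ j ⁆ ∪ ⁅ l ⁆)

module _ {n} {i j l : Fin n} where
  ∈-triple⁻ : ∀ {t} → t ∈ₛ triple i j l → t ≡ i ⊎ t ≡ j ⊎ t ≡ l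
  ∈-triple⁻ t∈ with x∈p∪q⁻ ⁅ i ⁆ (⁅ j ⁆ ∪ ⁅ l ⁆) t∈
  ... | inj₁ t∈i = inj₁ (x∈⁅y⁆⇒x≡y _ t∈i)
  ... | inj₂ t∈jl with x∈p∪q⁻ ⁅ j ⁆ ⁅ l ⁆ t∈jl
  ...   | inj₁ t∈j = inj₂ (inj₁ (x∈⁅y⁆⇒x≡y _ t∈j))
  ...   | inj₂ t∈l = inj₂ (inj₂ (x∈⁅y⁆⇒x≡y _ t∈l))

  ∈-triple⁺ : ∀ {t} → t ≡ i ⊎ t ≡ j ⊎ t ≡ l → t ∈ₛ triple i j l
  ∈-triple⁺ (inj₁ refl) = x∈p∪q⁺ (inj₁ (x∈⁅x⁆ _))
  ∈-triple⁺ (inj₂ (inj₁ refl)) = x∈p∪q⁺ {p = ⁅ i ⁆} (inj₂ (x∈p∪q⁺ (inj₁ (x∈⁅x⁆ _))))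
  ∈-triple⁺ (inj₂ (inj₂ refl)) = x∈p∪q⁺ {p = ⁅ i ⁆} (inj₂ (x∈p∪q⁺ {p = ⁅ j ⁆} (inj₂ (x∈⁅x⁆ _))))

  ∣triple∣≡3 : i ≢ j → j ≢ l → l ≢ i → ∣ triple i j l ∣ ≡ 3
  ∣triple∣≡3 i≢j j≢l l≢i = begin
    ∣ triple i j l ∣                                                       ≡⟨ ∣p∣≡∑ (triple i j l) ⟩
    ∑ (allFin n) (λ t → 𝟙 (t ∈? triple i j l))                             ≡⟨ ∑-cong (allFin n) pointwise ⟩
    ∑ (allFin n) (λ t → 𝟙 (t Fin.≟ i) ℕ.+ (𝟙 (t Fin.≟ j) ℕ.+ 𝟙 (t Fin.≟ l)))
      ≡⟨ trans (∑-+ (allFin n) _ _) (cong (∑ (allFin n) (λ t → 𝟙 (t Fin.≟ i)) ℕ.+_) (∑-+ (allFin n) _ _)) ⟩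
    ∑ (allFin n) (λ t → 𝟙 (t Fin.≟ i)) ℕ.+ (∑ (allFin n) (λ t → 𝟙 (t Fin.≟ j)) ℕ.+ ∑ (allFin n) (λ t → 𝟙 (t Fin.≟ l)))
      ≡⟨ cong₂ ℕ._+_ (δ i) (cong₂ ℕ._+_ (δ j) (δ l)) ⟩
    3                                                                      ∎
    where
    open ≡-Reasoning
    δ = once (Fin-finite n)
    pointwise : ∀ t → 𝟙 (t ∈? triple i j l) ≡ 𝟙 (t Fin.≟ i) ℕ.+ (𝟙 (t Fin.≟ j) ℕ.+ 𝟙 (t Fin.≟ l))
    pointwise t with t Fin.≟ i | t Fin.≟ j | t Fin.≟ l
    ... | yes refl | yes refl | _ = contradiction refl i≢j
    ... | yes refl | no _ | yes refl = contradiction refl l≢i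
    ... | no _ | yes refl | yes refl = contradiction refl j≢l
    ... | yes e | no _ | no _ = 𝟙-true (t ∈? triple i j l) (∈-triple⁺ (inj₁ e))
    ... | no _ | yes e | no _ = 𝟙-true (t ∈? triple i j l) (∈-triple⁺ (inj₂ (inj₁ e)))
    ... | no _ | no _ | yes e = 𝟙-true (t ∈? triple i j l) (∈-triple⁺ (inj₂ (inj₂ e)))
    ... | no ¬i | no ¬j | no ¬l = 𝟙-false (t ∈? triple i j l) (λ t∈ → [ ¬i , [ ¬j , ¬l ]′ ]′ (∈-triple⁻ t∈))

  𝟙-triple-⊆ : ∀ D → 𝟙 (triple i j l ⊆? D) ≡ 𝟙 (i ∈? D) ℕ.* (𝟙 (j ∈? D) ℕ.* 𝟙 (l ∈? D))
  𝟙-triple-⊆ D = trans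
    (𝟙-cong (triple i j l ⊆? D) (i ∈? D ×-dec (j ∈? D ×-dec l ∈? D))
      (λ T⊆D → T⊆D (∈-triple⁺ (inj₁ refl)) , T⊆D (∈-triple⁺ (inj₂ (inj₁ refl))) , T⊆D (∈-triple⁺ (inj₂ (inj₂ refl))))
      (λ { (i∈ , j∈ , l∈) t∈ → [ (λ { refl → i∈ }) , [ (λ { refl → j∈ }) , (λ { refl → l∈ }) ]′ ]′ (∈-triple⁻ t∈) }))
    (trans (𝟙-×-dec (i ∈? D) (j ∈? D ×-dec l ∈? D))
      (cong (𝟙 (i ∈? D) ℕ.*_) (𝟙-×-dec (j ∈? D) (l ∈? D))))

-- The projective line and the square class of a triple.

module ProjectiveLine {q : ℕ} (F : FiniteField q) (q%4≡1 : q % 4 ≡ 1) where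
  open SquareClasses F q%4≡1 public

  -- Homogeneous coordinates (u : v) with ∞ = (1 : 0).
  u v : Point F → Carrier
  u nothing = 1#
  u (just x) = x
  v nothing = 0#
  v (just x) = 1#

  -- The determinant of the two coordinate vectors; on finite points it is their difference.
  δ : Point F → Point F → Carrier
  δ p r = u p * v r - u r * v p

  -- The square class of Δ separates the two PSL(2,q)-orbits on triples.
  Δ : Point F → Point F → Point F → Carrier
  Δ p r s = δ p r * δ r s * δ s p

  δ-diagonal : ∀ p → δ p p ≡ 0#
  δ-diagonal p = -‿inverseʳ _

  Δ≢0⇒distinct : ∀ {p r s} → Δ p r s ≢ 0# → p ≢ r × r ≢ s × s ≢ p
  Δ≢0⇒distinct {p} {r} {s} Δ≢0 =
    (λ { refl → *-≢0ˡ (*-≢0ˡ Δ≢0) (δ-diagonal p) }) ,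
    (λ { refl → *-≢0ʳ (*-≢0ˡ Δ≢0) (δ-diagonal r) }) ,
    (λ { refl → *-≢0ʳ Δ≢0 (δ-diagonal s) })

  indexₚ : Point F → Fin (suc q)
  indexₚ nothing = 0F
  indexₚ (just x) = Fin.suc (index x)

  pt-indexₚ : ∀ p → pt F (indexₚ p) ≡ p
  pt-indexₚ nothing = refl
  pt-indexₚ (just x) = cong just (elt-index x)

  indexₚ-pt : ∀ i → indexₚ (pt F i) ≡ i
  indexₚ-pt 0F = refl
  indexₚ-pt (Fin.suc i) = cong Fin.suc (index-elt i)

  I : List (Fin (suc q))
  I = allFin (suc q)

  infix 4 _≟ₚ′_
  _≟ₚ′_ = _≟ₚ_ F

  Point-finite : Finite (Point F)
  Point-finite = record
    { elements = map (pt F) I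
    ; _≟_ = _≟ₚ′_
    ; once = λ p → trans (∑-map (pt F) I _) (trans
        (∑-cong I (λ i → 𝟙-cong (pt F i ≟ₚ′ p) (i Fin.≟ indexₚ p)
          (λ { refl → sym (indexₚ-pt i) }) (λ { refl → pt-indexₚ p })))
        (once (Fin-finite (suc q)) (indexₚ p)))
    }

  ∑-pt-permute : (to from : Point F → Point F) →
    (∀ p → from (to p) ≡ p) → (∀ p → to (from p) ≡ p) →
    ∀ f → ∑ I (λ i → f (to (pt F i))) ≡ ∑ I (λ i → f (pt F i))
  ∑-pt-permute to from from-to to-from f = trans (sym (∑-map (pt F) I (f ∘ to)))
    (trans (∑-reindex Point-finite Point-finite to from from-to to-from f) (∑-map (pt F) I f))

  ∑³ : (Carrier → ℕ) → ℕ
  ∑³ w = ∑ I (λ i → ∑ I (λ j → ∑ I (λ l → w (Δ (pt F i) (pt F j) (pt F l)))))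

  scale : Carrier → Point F → Point F
  scale c nothing = nothing
  scale c (just x) = just (c * x)

  -- The matrix diag(c, 1) multiplies each of the three determinants by c, and c³ has the class of
  -- c. The factor κ undoes the renormalisation of (c : 0) to (1 : 0); it enters twice for each
  -- point, hence as a square.
  Δ-scale : ∀ {c} → c ≢ 0# → ∀ {w} → SquareClassFunction w → ∀ p r s →
    w (Δ (scale c p) (scale c r) (scale c s)) ≡ w (c * Δ p r s)
  Δ-scale {c} c≢0 {w} W p r s = begin
    w (Δ (scale c p) (scale c r) (scale c s))
      ≡⟨ square-* W (*-≢0 (κ≢0 p) (*-≢0 (κ≢0 r) (κ≢0 s))) _ ⟨
    w (κ p * (κ r * κ s) * (κ p * (κ r * κ s)) * Δ (scale c p) (scale c r) (scale c s))
      ≡⟨ cong w (trans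
          (solve 6 (λ a b d x y z → a :* (b :* d) :* (a :* (b :* d)) :* (x :* y :* z) :=
                                     (a :* b :* x) :* (b :* d :* y) :* (d :* a :* z)) refl (κ p) (κ r) (κ s) _ _ _)
          (trans (cong₂ _*_ (cong₂ _*_ (δ-scale p r) (δ-scale r s)) (δ-scale s p))
            (solve 4 (λ c x y z → c :* x :* (c :* y) :* (c :* z) := c :* c :* (c :* (x :* y :* z))) refl c _ _ _))) ⟩
    w (c * c * (c * Δ p r s))
      ≡⟨ square-* W c≢0 _ ⟩
    w (c * Δ p r s) ∎
    where
    open ≡-Reasoning
    κ : Point F → Carrier
    κ nothing = c
    κ (just x) = 1#

    κ≢0 : ∀ p → κ p ≢ 0#
    κ≢0 nothing = c≢0
    κ≢0 (just x) e = 0≢1 (sym e)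

    κu : ∀ p → κ p * u (scale c p) ≡ c * u p
    κu nothing = refl
    κu (just x) = *-identityˡ _

    κv : ∀ p → κ p * v (scale c p) ≡ v p
    κv nothing = zeroʳ c
    κv (just x) = *-identityˡ _

    δ-scale : ∀ p r → κ p * κ r * δ (scale c p) (scale c r) ≡ c * δ p r
    δ-scale p r = begin
      κ p * κ r * δ (scale c p) (scale c r)
        ≡⟨ solve 6 (λ k k′ u v u′ v′ → k :* k′ :* (u :* v′ :- u′ :* v) := k :* u :* (k′ :* v′) :- k′ :* u′ :* (k :* v))
             refl (κ p) (κ r) (u (scale c p)) (v (scale c p)) (u (scale c r)) (v (scale c r)) ⟩
      κ p * u (scale c p) * (κ r * v (scale c r)) - κ r * u (scale c r) * (κ p * v (scale c p))
        ≡⟨ cong₂ _-_ (cong₂ _*_ (κu p) (κv r)) (cong₂ _*_ (κu r) (κv p)) ⟩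
      c * u p * v r - c * u r * v p
        ≡⟨ solve 5 (λ c u v u′ v′ → c :* u :* v′ :- c :* u′ :* v := c :* (u :* v′ :- u′ :* v)) refl c (u p) (v p) (u r) (v r) ⟩
      c * δ p r ∎

  -- Scaling by the nonsquare η permutes the points and exchanges the classes of all nondegenerate
  -- triples.
  ∑³-residue≡∑³-nonresidue : ∑³ residue ≡ ∑³ nonresidue
  ∑³-residue≡∑³-nonresidue = begin
    ∑³ residue
      ≡⟨ permute (λ p → ∑ I (λ j → ∑ I (λ l → residue (Δ p (pt F j) (pt F l))))) ⟨
    ∑ I (λ i → ∑ I (λ j → ∑ I (λ l → residue (Δ (η· i) (pt F j) (pt F l)))))
      ≡⟨ ∑-cong I (λ i → permute (λ p → ∑ I (λ l → residue (Δ (η· i) p (pt F l))))) ⟨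
    ∑ I (λ i → ∑ I (λ j → ∑ I (λ l → residue (Δ (η· i) (η· j) (pt F l)))))
      ≡⟨ ∑-cong I (λ i → ∑-cong I (λ j → permute (λ p → residue (Δ (η· i) (η· j) p)))) ⟨
    ∑ I (λ i → ∑ I (λ j → ∑ I (λ l → residue (Δ (η· i) (η· j) (η· l)))))
      ≡⟨ ∑-cong I (λ i → ∑-cong I (λ j → ∑-cong I (λ l →
           trans (Δ-scale η≢0 residue-class (pt F i) (pt F j) (pt F l)) (residue-η* _)))) ⟩
    ∑³ nonresidue ∎
    where
    open ≡-Reasoning
    η· : Fin (suc q) → Point F
    η· i = scale η (pt F i)

    permute : ∀ f → ∑ I (λ i → f (η· i)) ≡ ∑ I (λ i → f (pt F i))
    permute = ∑-pt-permute (scale η) (scale (η ⁻¹))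
      (λ { nothing → refl ; (just x) → cong just (*-divideˡ η≢0 x) })
      (λ { nothing → refl ; (just x) → cong just (*-divideˡ′ η≢0 x) })

  module _ (g : Mat F) (det≡1 : det F g ≡ 1#) where
    private
      a = proj₁ g
      b = proj₁ (proj₂ g)
      c = proj₁ (proj₂ (proj₂ g))
      d = proj₂ (proj₂ (proj₂ g))

      _· : Carrier → Point F
      x · = act F g (just x)

    numerator-or-denominator≢0 : ∀ x → c * x + d ≡ 0# → a * x + b ≢ 0#
    numerator-or-denominator≢0 x M≡0 N≡0 = 0≢1 (sym (begin
      1#                                     ≡⟨ det≡1 ⟨
      a * d + - (b * c)                      ≡⟨ solve 5 (λ a b c d x → a :* d :+ (:- (b :* c)) := a :* (c :* x :+ d) :- c :* (a :* x :+ b)) refl a b c d x ⟩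
      a * (c * x + d) - c * (a * x + b)      ≡⟨ cong₂ (λ M N → a * M - c * N) M≡0 N≡0 ⟩
      a * 0# - c * 0#                        ≡⟨ solve 2 (λ a c → a :* :0 :- c :* :0 := :0) refl a c ⟩
      0#                                     ∎))
      where open ≡-Reasoning

    -- `act` returns normalised coordinates; μ is the scalar it divides out, so that μ (u : v) is
    -- the honest matrix product of g with (x : 1). At a pole that scalar is the numerator.
    multiplier : ∀ x → ∃ λ μ → μ ≢ 0# × μ * u (x ·) ≡ a * x + b × μ * v (x ·) ≡ c * x + d
    multiplier x with c * x + d ≟ 0#
    ... | yes M≡0 = a * x + b , numerator-or-denominator≢0 x M≡0 , *-identityʳ _ , trans (zeroʳ _) (sym M≡0)
    ... | no M≢0 = c * x + d , M≢0 ,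
      trans (cong ((c * x + d) *_) (*-comm _ _)) (*-divideˡ′ M≢0 (a * x + b)) , *-identityʳ _

    μ : Carrier → Carrier
    μ x = proj₁ (multiplier x)

    μ≢0 : ∀ x → μ x ≢ 0#
    μ≢0 x = proj₁ (proj₂ (multiplier x))

    δ-act : ∀ x y → μ x * μ y * δ (x ·) (y ·) ≡ x - y
    δ-act x y = begin
      μ x * μ y * δ (x ·) (y ·)
        ≡⟨ solve 6 (λ k k′ u v u′ v′ → k :* k′ :* (u :* v′ :- u′ :* v) := k :* u :* (k′ :* v′) :- k′ :* u′ :* (k :* v))
             refl (μ x) (μ y) (u (x ·)) (v (x ·)) (u (y ·)) (v (y ·)) ⟩
      μ x * u (x ·) * (μ y * v (y ·)) - μ y * u (y ·) * (μ x * v (x ·))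
        ≡⟨ cong₂ _-_ (cong₂ _*_ (μu x) (μv y)) (cong₂ _*_ (μu y) (μv x)) ⟩
      (a * x + b) * (c * y + d) - (a * y + b) * (c * x + d)
        ≡⟨ solve 6 (λ a b c d x y → (a :* x :+ b) :* (c :* y :+ d) :- (a :* y :+ b) :* (c :* x :+ d)
                                     := (a :* d :+ (:- (b :* c))) :* (x :- y)) refl a b c d x y ⟩
      (a * d + - (b * c)) * (x - y)
        ≡⟨ cong (_* (x - y)) det≡1 ⟩
      1# * (x - y)
        ≡⟨ *-identityˡ _ ⟩
      x - y ∎
      where
      open ≡-Reasoning
      μu = λ x → proj₁ (proj₂ (proj₂ (multiplier x)))
      μv = λ x → proj₂ (proj₂ (proj₂ (multiplier x)))

    act-injective : ∀ {x y} → x · ≡ y · → x ≡ y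
    act-injective {x} {y} e = x-y≡0⇒x≡y (trans (sym (δ-act x y))
      (trans (cong (λ p → μ x * μ y * δ (x ·) p) (sym e))
        (trans (cong (μ x * μ y *_) (δ-diagonal (x ·))) (zeroʳ _))))

    -- Determinants are preserved up to multipliers because det g = 1, and each point occurs in two
    -- factors of `Δ`, so its multiplier enters as a square.
    Δ-act : ∀ {w} → SquareClassFunction w → ∀ x y z → w (Δ (x ·) (y ·) (z ·)) ≡ w (D x y z)
    Δ-act {w} W x y z = begin
      w (Δ (x ·) (y ·) (z ·))
        ≡⟨ square-* W (*-≢0 (μ≢0 x) (*-≢0 (μ≢0 y) (μ≢0 z))) _ ⟨
      w (μ x * (μ y * μ z) * (μ x * (μ y * μ z)) * Δ (x ·) (y ·) (z ·))
        ≡⟨ cong w (trans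
            (solve 6 (λ a b d x y z → a :* (b :* d) :* (a :* (b :* d)) :* (x :* y :* z) :=
                                       (a :* b :* x) :* (b :* d :* y) :* (d :* a :* z)) refl (μ x) (μ y) (μ z) _ _ _)
            (cong₂ _*_ (cong₂ _*_ (δ-act x y) (δ-act y z)) (δ-act z x))) ⟩
      w (D x y z) ∎
      where open ≡-Reasoning

  -- Weighted incidences between triples and blocks.

  module Design (B : Subset q) where
    ∈B? : ∀ x → Dec (index x ∈ₛ B)
    ∈B? x = index x ∈? B

    β : Carrier → ℕ
    β x = 𝟙 (∈B? x)

    ∑β≡∣B∣ : ∑ E β ≡ ∣ B ∣
    ∑β≡∣B∣ = trans (∑-E β) (trans
      (∑-cong (allFin q) (λ i → cong (λ j → 𝟙 (j ∈? B)) (index-elt i))) (sym (∣p∣≡∑ B)))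

    ∑B : (Carrier → ℕ) → ℕ
    ∑B f = ∑ E (λ x → β x ℕ.* f x)

    ∑B³ : (Carrier → ℕ) → ℕ
    ∑B³ w = ∑B (λ x → ∑B (λ y → ∑B (λ z → w (D x y z))))

    ∑B-cong : ∀ {f g} → (∀ x → f x ≡ g x) → ∑B f ≡ ∑B g
    ∑B-cong f≡g = ∑-cong E (λ x → cong (β x ℕ.*_) (f≡g x))

    ∑∈ : Subset (suc q) → (Fin (suc q) → ℕ) → ℕ
    ∑∈ D f = ∑ I (λ i → 𝟙 (i ∈? D) ℕ.* f i)

    ∑∈-cong : ∀ D {f g} → (∀ i → f i ≡ g i) → ∑∈ D f ≡ ∑∈ D g
    ∑∈-cong D f≡g = ∑-cong I (λ i → cong (𝟙 (i ∈? D) ℕ.*_) (f≡g i))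

    module _ (g : Mat F) (det≡1 : det F g ≡ 1#) where
      hit? : ∀ i → Dec (∃ λ j → j ∈ₛ B × act F g (just (elt F j)) ≡ pt F i)
      hit? i = Fin.any? (λ j → (j ∈? B) ×-dec (act F g (just (elt F j)) ≟ₚ′ pt F i))

      ∈-image⁻ : ∀ {i} → i ∈ₛ image F B g → ∃ λ j → j ∈ₛ B × act F g (just (elt F j)) ≡ pt F i
      ∈-image⁻ {i} i∈ with hit? i | trans (sym (lookup∘tabulate (λ i → does (hit? i)) i)) ([]=⇒lookup i∈)
      ... | yes h | _ = h
      ... | no _ | ()

      ∈-image⁺ : ∀ {i} → (∃ λ j → j ∈ₛ B × act F g (just (elt F j)) ≡ pt F i) → i ∈ₛ image F B g
      ∈-image⁺ {i} h = lookup⇒[]= i _ (trans (lookup∘tabulate (λ i → does (hit? i)) i) (dec-true (hit? i) h))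

      -- By injectivity of g at most one x in B hits the point. Membership thus becomes a sum over
      -- B, which lets sums over a block be pulled back to B.
      𝟙-image : ∀ i → 𝟙 (i ∈? image F B g) ≡ ∑B (λ x → 𝟙 (pt F i ≟ₚ′ act F g (just x)))
      𝟙-image i with i ∈? image F B g
      ... | no i∉ = sym (∑-zero E (λ x → trans (sym (𝟙-×-dec (∈B? x) (pt F i ≟ₚ′ act F g (just x))))
        (𝟙-false (∈B? x ×-dec (pt F i ≟ₚ′ act F g (just x)))
          (λ (x∈ , e) → i∉ (∈-image⁺ (index x , x∈ , trans (cong (act F g ∘ just) (elt-index x)) (sym e)))))))
      ... | yes i∈ with ∈-image⁻ i∈
      ...   | j , j∈ , e = sym (begin
        ∑B (λ x → 𝟙 (pt F i ≟ₚ′ act F g (just x)))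
          ≡⟨ ∑B-cong (λ x → 𝟙-cong (pt F i ≟ₚ′ act F g (just x)) (x ≟ elt F j)
               (λ e′ → act-injective g det≡1 (sym (trans e e′))) (λ { refl → sym e })) ⟩
        ∑B (λ x → 𝟙 (x ≟ elt F j))
          ≡⟨ ∑-cong E (λ x → ℕ.*-comm (β x) _) ⟩
        ∑ E (λ x → 𝟙 (x ≟ elt F j) ℕ.* β x)
          ≡⟨ ∑-pick Carrier-finite (elt F j) β ⟩
        β (elt F j)
          ≡⟨ 𝟙-true (∈B? (elt F j)) (subst (_∈ₛ B) (sym (index-elt j)) j∈) ⟩
        1 ∎)
        where open ≡-Reasoning

      ∑∈-image : ∀ f → ∑∈ (image F B g) (f ∘ pt F) ≡ ∑B (λ x → f (act F g (just x)))
      ∑∈-image f = begin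
        ∑ I (λ i → 𝟙 (i ∈? image F B g) ℕ.* f (pt F i))
          ≡⟨ ∑-cong I (λ i → trans (cong (ℕ._* f (pt F i)) (𝟙-image i)) (sym (∑-*ʳ E _ (f (pt F i))))) ⟩
        ∑ I (λ i → ∑ E (λ x → β x ℕ.* 𝟙 (pt F i ≟ₚ′ act F g (just x)) ℕ.* f (pt F i)))
          ≡⟨ ∑-swap I E _ ⟩
        ∑ E (λ x → ∑ I (λ i → β x ℕ.* 𝟙 (pt F i ≟ₚ′ act F g (just x)) ℕ.* f (pt F i)))
          ≡⟨ ∑-cong E (λ x → trans (∑-cong I (λ i → ℕ.*-assoc (β x) _ _)) (∑-*ˡ I (β x) _)) ⟩
        ∑B (λ x → ∑ I (λ i → 𝟙 (pt F i ≟ₚ′ act F g (just x)) ℕ.* f (pt F i)))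
          ≡⟨ ∑B-cong (λ x → trans (sym (∑-map (pt F) I _)) (∑-pick Point-finite (act F g (just x)) f)) ⟩
        ∑B (λ x → f (act F g (just x))) ∎
        where open ≡-Reasoning

      -- Pulling back the three summations one at a time leaves triples of B moved by g, and g does
      -- not change their class. All blocks therefore carry the same weight.
      ∑-triples-image : ∀ {w} → SquareClassFunction w →
        ∑∈ (image F B g) (λ i → ∑∈ (image F B g) (λ j → ∑∈ (image F B g) (λ l →
          w (Δ (pt F i) (pt F j) (pt F l))))) ≡ ∑B³ w
      ∑-triples-image {w} W = begin
        ∑∈ C (λ i → ∑∈ C (λ j → ∑∈ C (λ l → w (Δ (pt F i) (pt F j) (pt F l)))))
          ≡⟨ ∑∈-cong C (λ i → ∑∈-cong C (λ j → ∑∈-image (λ s → w (Δ (pt F i) (pt F j) s)))) ⟩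
        ∑∈ C (λ i → ∑∈ C (λ j → ∑B (λ z → w (Δ (pt F i) (pt F j) (z ·)))))
          ≡⟨ ∑∈-cong C (λ i → ∑∈-image (λ r → ∑B (λ z → w (Δ (pt F i) r (z ·))))) ⟩
        ∑∈ C (λ i → ∑B (λ y → ∑B (λ z → w (Δ (pt F i) (y ·) (z ·)))))
          ≡⟨ ∑∈-image (λ p → ∑B (λ y → ∑B (λ z → w (Δ p (y ·) (z ·))))) ⟩
        ∑B (λ x → ∑B (λ y → ∑B (λ z → w (Δ (x ·) (y ·) (z ·)))))
          ≡⟨ ∑B-cong (λ x → ∑B-cong (λ y → ∑B-cong (λ z → Δ-act g det≡1 W x y z))) ⟩
        ∑B³ w ∎
        where
        open ≡-Reasoning
        C = image F B g
        _· : Carrier → Point F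
        x · = act F g (just x)

    -- The list that `SL2` filters, named so that membership in the filtered list can be inverted.
    matrices : List (Mat F)
    matrices = concatMap (λ a → concatMap (λ b → concatMap (λ c → map (λ d →
      (elt F a , elt F b , elt F c , elt F d)) (allFin q)) (allFin q)) (allFin q)) (allFin q)

    ∈-orbit⁻ : ∀ {C} → C ∈ orbit F B → ∃ λ g → det F g ≡ 1# × C ≡ image F B g
    ∈-orbit⁻ C∈ with ∈-map⁻ (image F B) (∈-deduplicate⁻ (≡-dec Bool._≟_) (map (image F B) (SL2 F)) C∈)
    ... | g , g∈ , C≡ = g , proj₂ (∈-filter⁻ (λ m → det F m ≟ 1#) {xs = matrices} g∈) , C≡

    module _ (design : Gives3Design F B) where
      lam : ℕ
      lam = proj₁ design

      blocks : List (Subset (suc q))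
      blocks = orbit F B

      ∑-blocks : ∀ {i j l} → i ≢ j → j ≢ l → l ≢ i →
        ∑ blocks (λ C → 𝟙 (triple i j l ⊆? C)) ≡ lam
      ∑-blocks {i} {j} {l} i≢j j≢l l≢i = trans (sym (∑-filter (triple i j l ⊆?_) blocks))
        (proj₂ (proj₂ design) (triple i j l) (∣triple∣≡3 i≢j j≢l l≢i))

      -- Both sides weigh the pairs of a triple and a block containing it: summed by triples, each
      -- lies in `lam` blocks; summed by blocks, each contributes as much as B.
      double-count : ∀ {w} → SquareClassFunction w → lam ℕ.* ∑³ w ≡ length blocks ℕ.* ∑B³ w
      double-count {w} W = begin
        lam ℕ.* ∑³ w
          ≡⟨ trans (sym (∑-*ˡ I lam _)) (∑-cong I (λ i → trans (sym (∑-*ˡ I lam _)) (∑-cong I (λ j → sym (∑-*ˡ I lam _))))) ⟩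
        ∑ I (λ i → ∑ I (λ j → ∑ I (λ l → lam ℕ.* ω i j l)))
          ≡⟨ ∑-cong I (λ i → ∑-cong I (λ j → ∑-cong I (λ l → spread i j l))) ⟩
        ∑ I (λ i → ∑ I (λ j → ∑ I (λ l → ∑ blocks (λ C → 𝟙 (i ∈? C) ℕ.* (𝟙 (j ∈? C) ℕ.* (𝟙 (l ∈? C) ℕ.* ω i j l))))))
          ≡⟨ ∑-cong I (λ i → ∑-cong I (λ j → pull-out (λ C l → 𝟙 (i ∈? C) ℕ.* (𝟙 (j ∈? C) ℕ.* (𝟙 (l ∈? C) ℕ.* ω i j l))))) ⟩
        ∑ I (λ i → ∑ I (λ j → ∑ blocks (λ C → ∑ I (λ l → 𝟙 (i ∈? C) ℕ.* (𝟙 (j ∈? C) ℕ.* (𝟙 (l ∈? C) ℕ.* ω i j l))))))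
          ≡⟨ ∑-cong I (λ i → pull-out (λ C j → ∑ I (λ l → 𝟙 (i ∈? C) ℕ.* (𝟙 (j ∈? C) ℕ.* (𝟙 (l ∈? C) ℕ.* ω i j l))))) ⟩
        ∑ I (λ i → ∑ blocks (λ C → ∑ I (λ j → ∑ I (λ l → 𝟙 (i ∈? C) ℕ.* (𝟙 (j ∈? C) ℕ.* (𝟙 (l ∈? C) ℕ.* ω i j l))))))
          ≡⟨ pull-out (λ C i → ∑ I (λ j → ∑ I (λ l → 𝟙 (i ∈? C) ℕ.* (𝟙 (j ∈? C) ℕ.* (𝟙 (l ∈? C) ℕ.* ω i j l))))) ⟩
        ∑ blocks (λ C → ∑ I (λ i → ∑ I (λ j → ∑ I (λ l → 𝟙 (i ∈? C) ℕ.* (𝟙 (j ∈? C) ℕ.* (𝟙 (l ∈? C) ℕ.* ω i j l))))))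
          ≡⟨ ∑-cong blocks (λ C → ∑-cong I (λ i → trans
               (∑-cong I (λ j → trans (∑-*ˡ I (𝟙 (i ∈? C)) _) (cong (𝟙 (i ∈? C) ℕ.*_) (∑-*ˡ I (𝟙 (j ∈? C)) _))))
               (∑-*ˡ I (𝟙 (i ∈? C)) _))) ⟩
        ∑ blocks (λ C → ∑∈ C (λ i → ∑∈ C (λ j → ∑∈ C (λ l → ω i j l))))
          ≡⟨ ∑-cong-∈ blocks block-sum ⟩
        ∑ blocks (λ C → ∑B³ w)
          ≡⟨ ∑-cong blocks (λ _ → ℕ.*-identityˡ (∑B³ w)) ⟨
        ∑ blocks (λ C → 1 ℕ.* ∑B³ w)
          ≡⟨ trans (∑-*ʳ blocks _ (∑B³ w)) (cong (ℕ._* ∑B³ w) (∑-1 blocks)) ⟩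
        length blocks ℕ.* ∑B³ w ∎
        where
        open ≡-Reasoning
        ω : Fin (suc q) → Fin (suc q) → Fin (suc q) → ℕ
        ω i j l = w (Δ (pt F i) (pt F j) (pt F l))

        pull-out : ∀ (f : Subset (suc q) → Fin (suc q) → ℕ) →
          ∑ I (λ i → ∑ blocks (λ C → f C i)) ≡ ∑ blocks (λ C → ∑ I (f C))
        pull-out f = ∑-swap I blocks (λ i C → f C i)

        block-sum : ∀ {C} → C ∈ blocks → ∑∈ C (λ i → ∑∈ C (λ j → ∑∈ C (λ l → ω i j l))) ≡ ∑B³ w
        block-sum C∈ with ∈-orbit⁻ C∈
        ... | g , det≡1 , refl = ∑-triples-image g det≡1 W

        weight : ∀ i j l C → 𝟙 (triple i j l ⊆? C) ℕ.* ω i j l ≡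
          𝟙 (i ∈? C) ℕ.* (𝟙 (j ∈? C) ℕ.* (𝟙 (l ∈? C) ℕ.* ω i j l))
        weight i j l C = trans (cong (ℕ._* ω i j l) (𝟙-triple-⊆ {i = i} {j} {l} C))
          (trans (ℕ.*-assoc (𝟙 (i ∈? C)) (𝟙 (j ∈? C) ℕ.* 𝟙 (l ∈? C)) (ω i j l))
            (cong (𝟙 (i ∈? C) ℕ.*_) (ℕ.*-assoc (𝟙 (j ∈? C)) (𝟙 (l ∈? C)) (ω i j l))))

        -- The design condition concerns distinct points only; a triple with a repetition has weight
        -- 0, so the equation holds there trivially.
        lam-or-zero : ∀ i j l → lam ℕ.* ω i j l ≡ ∑ blocks (λ C → 𝟙 (triple i j l ⊆? C)) ℕ.* ω i j l
        lam-or-zero i j l with ω i j l ℕ.≟ 0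
        ... | yes ω≡0 = trans (cong (lam ℕ.*_) ω≡0) (trans (ℕ.*-zeroʳ lam)
          (sym (trans (cong (∑ blocks (λ C → 𝟙 (triple i j l ⊆? C)) ℕ.*_) ω≡0) (ℕ.*-zeroʳ (∑ blocks (λ C → 𝟙 (triple i j l ⊆? C)))))))
        ... | no ω≢0 = cong (ℕ._* ω i j l) (sym (∑-blocks {i} {j} {l}
              (λ { refl → p≢r refl }) (λ { refl → r≢s refl }) (λ { refl → s≢p refl })))
          where
          distinct = Δ≢0⇒distinct {pt F i} {pt F j} {pt F l} (≢0 W ω≢0)
          p≢r = proj₁ distinct
          r≢s = proj₁ (proj₂ distinct)
          s≢p = proj₂ (proj₂ distinct)

        spread : ∀ i j l → lam ℕ.* ω i j l ≡
          ∑ blocks (λ C → 𝟙 (i ∈? C) ℕ.* (𝟙 (j ∈? C) ℕ.* (𝟙 (l ∈? C) ℕ.* ω i j l)))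
        spread i j l = trans (lam-or-zero i j l) (trans (sym (∑-*ʳ blocks _ (ω i j l)))
          (∑-cong blocks (weight i j l)))

      -- Since `lam` is positive, some block contains ∞, 0 and 1.
      blocks≢[] : length blocks ≢ 0
      blocks≢[] ∣blocks∣≡0 = ℕ.<⇒≢ (proj₁ (proj₂ design)) (sym (trans
        (sym (∑-blocks {0F} {Fin.suc (index 0#)} {Fin.suc (index 1#)} (λ ())
          (λ e → 0≢1 (trans (sym (elt-index 0#)) (trans (cong (elt F) (Fin.suc-injective e)) (elt-index 1#)))) (λ ())))
        (∑-empty blocks ∣blocks∣≡0)))
        where
        ∑-empty : ∀ {A : Set} (xs : List A) {f} → length xs ≡ 0 → ∑ xs f ≡ 0
        ∑-empty [] _ = refl

      balanced : ∑B³ residue ≡ ∑B³ nonresidue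
      balanced = ℕ.*-cancelˡ-≡ _ _ (length blocks) ⦃ ℕ.≢-nonZero blocks≢[] ⦄
        (trans (sym (double-count residue-class)) (trans (cong (lam ℕ.*_) ∑³-residue≡∑³-nonresidue)
          (double-count nonresidue-class)))

-- Normalised triples (1, y, z) in a subgroup of squares.

m*n≢0⇒m≢0×n≢0 : ∀ {m n} → m ℕ.* n ≢ 0 → m ≢ 0 × n ≢ 0
m*n≢0⇒m≢0×n≢0 {m} mn≢0 = (λ { refl → mn≢0 refl }) , (λ { refl → mn≢0 (ℕ.*-zeroʳ m) })

module SquareSubgroup {q : ℕ} (F : FiniteField q) (q%4≡1 : q % 4 ≡ 1)
  (G : Field.Subgroup F) (squares : ∀ {x} → Field.Subgroup.Member G x → Field.IsSquare F x) where
  open SquareClasses F q%4≡1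
  open Subgroup G

  β : Carrier → ℕ
  β x = 𝟙 (member? x)

  β≢0 : ∀ {x} → β x ≢ 0 → Member x
  β≢0 {x} = 𝟙-holds (member? x)

  ∑G : (Carrier → ℕ) → ℕ
  ∑G f = ∑ E (λ x → β x ℕ.* f x)

  Q : Carrier → Carrier → Carrier
  Q y z = D 1# y z

  pairs : Finite (Carrier × Carrier)
  pairs = ×-finite Carrier-finite Carrier-finite

  weight : (Carrier → ℕ) → Carrier × Carrier → ℕ
  weight w (y , z) = β y ℕ.* (β z ℕ.* w (Q y z))

  W : (Carrier → ℕ) → ℕ
  W w = ∑ (elements pairs) (weight w)

  W-nested : ∀ w → W w ≡ ∑G (λ y → ∑G (λ z → w (Q y z)))
  W-nested w = trans (∑-cartesianProduct E E (weight w)) (∑-cong E (λ y → ∑-*ˡ E (β y) _))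

  -- Dividing a triple by its first entry x stays inside the subgroup and divides `D` by x³, which
  -- is a square because x is one. Each x thus contributes the same amount.
  ∑G³≡order*W : ∀ {w} → SquareClassFunction w →
    ∑G (λ x → ∑G (λ y → ∑G (λ z → w (D x y z)))) ≡ order ℕ.* W w
  ∑G³≡order*W {w} C = trans (∑-cong E pointwise) (∑-*ʳ E β (W w))
    where
    open ≡-Reasoning
    β-* : ∀ {x} → Member x → ∀ y → β (x * y) ≡ β y
    β-* {x} x∈ y = 𝟙-cong (member? (x * y)) (member? y) (cancelˡ x∈) (*-closed x∈)

    homogeneous : ∀ {x} → Member x → ∀ y z → w (D x (x * y) (x * z)) ≡ w (Q y z)
    homogeneous {x} x∈ y z with squares x∈
    ... | s , refl = w-square C (*-≢0 (*-≢0 x≢0 x≢0) x≢0)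
      (s * s * s , solve 1 (λ s → s :* s :* (s :* s) :* (s :* s) := s :* s :* s :* (s :* s :* s)) refl s)
      (solve 3 (λ x y z → x :* x :* x :* ((:1 :- y) :* (y :- z) :* (z :- :1)) :=
        (x :- x :* y) :* (x :* y :- x :* z) :* (x :* z :- x)) refl x y z)
      where x≢0 = 0∉ x∈

    pointwise : ∀ x → β x ℕ.* ∑G (λ y → ∑G (λ z → w (D x y z))) ≡ β x ℕ.* W w
    pointwise x with member? x
    ... | no _ = refl
    ... | yes x∈ = cong (ℕ._+ 0) (begin
      ∑G (λ y → ∑G (λ z → w (D x y z)))
        ≡⟨ ∑-scale (0∉ x∈) (λ y → β y ℕ.* ∑G (λ z → w (D x y z))) ⟨
      ∑ E (λ y → β (x * y) ℕ.* ∑G (λ z → w (D x (x * y) z)))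
        ≡⟨ ∑-cong E (λ y → cong₂ ℕ._*_ (β-* x∈ y) (trans
             (sym (∑-scale (0∉ x∈) (λ z → β z ℕ.* w (D x (x * y) z))))
             (∑-cong E (λ z → cong₂ ℕ._*_ (β-* x∈ z) (homogeneous x∈ y z))))) ⟩
      ∑G (λ y → ∑G (λ z → w (Q y z)))
        ≡⟨ W-nested w ⟨
      W w ∎)

  Q≢0⇒ : ∀ {y z} → Q y z ≢ 0# → y ≢ 1# × z ≢ 1# × y ≢ z
  Q≢0⇒ Q≢0 =
    (λ { refl → *-≢0ˡ (*-≢0ˡ Q≢0) (-‿inverseʳ _) }) ,
    (λ { refl → *-≢0ʳ Q≢0 (-‿inverseʳ _) }) ,
    (λ { refl → *-≢0ʳ (*-≢0ˡ Q≢0) (-‿inverseʳ _) })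

  -- Inclusion-exclusion over the diagonals y = 1, z = 1 and y = z.
  count-pairs : W residue ℕ.+ W nonresidue ℕ.+ 3 ℕ.* order ≡ order ℕ.* order ℕ.+ 2
  count-pairs = begin
    W residue ℕ.+ W nonresidue ℕ.+ 3 ℕ.* order
      ≡⟨ cong₂ ℕ._+_ (∑-+ (elements pairs) (weight residue) (weight nonresidue))
           (cong (λ h → order ℕ.+ (order ℕ.+ h)) (sym (ℕ.+-identityʳ order))) ⟨
    ∑ (elements pairs) (λ t → weight residue t ℕ.+ weight nonresidue t) ℕ.+ (order ℕ.+ (order ℕ.+ order))
      ≡⟨ cong₂ ℕ._+_ (∑-cartesianProduct E E (λ t → weight residue t ℕ.+ weight nonresidue t))
           (sym (cong₂ ℕ._+_ ∑-y≡1 (cong₂ ℕ._+_ ∑-z≡1 ∑-y≡z))) ⟩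
    ∑∑ both ℕ.+ (∑∑ y≡1 ℕ.+ (∑∑ z≡1 ℕ.+ ∑∑ y≡z))
      ≡⟨ cong (∑∑ both ℕ.+_) (trans (∑∑-+ y≡1 _) (cong (∑∑ y≡1 ℕ.+_) (∑∑-+ z≡1 y≡z))) ⟨
    ∑∑ both ℕ.+ ∑∑ (λ y z → y≡1 y z ℕ.+ (z≡1 y z ℕ.+ y≡z y z))
      ≡⟨ ∑∑-+ both _ ⟨
    ∑∑ (λ y z → both y z ℕ.+ (y≡1 y z ℕ.+ (z≡1 y z ℕ.+ y≡z y z)))
      ≡⟨ ∑-cong E (λ y → ∑-cong E (λ z → trans
           (cong (ℕ._+ (y≡1 y z ℕ.+ (z≡1 y z ℕ.+ y≡z y z))) (merge y z)) (diagonals y z))) ⟩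
    ∑∑ (λ y z → β y ℕ.* β z ℕ.+ 𝟙 (y ≟ 1#) ℕ.* (𝟙 (z ≟ 1#) ℕ.* 2))
      ≡⟨ ∑∑-+ (λ y z → β y ℕ.* β z) _ ⟩
    ∑∑ (λ y z → β y ℕ.* β z) ℕ.+ ∑∑ (λ y z → 𝟙 (y ≟ 1#) ℕ.* (𝟙 (z ≟ 1#) ℕ.* 2))
      ≡⟨ cong₂ ℕ._+_
           (trans (∑-cong E (λ y → ∑-*ˡ E (β y) β)) (∑-*ʳ E β order))
           (trans (∑-cong E (λ y → ∑-*ˡ E (𝟙 (y ≟ 1#)) _))
             (trans (∑-pick Carrier-finite 1# (λ _ → ∑ E (λ z → 𝟙 (z ≟ 1#) ℕ.* 2)))
               (∑-pick Carrier-finite 1# (λ _ → 2)))) ⟩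
    order ℕ.* order ℕ.+ 2 ∎
    where
    open ≡-Reasoning
    both y≡1 z≡1 y≡z : Carrier → Carrier → ℕ
    both y z = weight residue (y , z) ℕ.+ weight nonresidue (y , z)
    y≡1 y z = 𝟙 (y ≟ 1#) ℕ.* β z
    z≡1 y z = 𝟙 (z ≟ 1#) ℕ.* β y
    y≡z y z = 𝟙 (z ≟ y) ℕ.* β z

    ∑∑ : (Carrier → Carrier → ℕ) → ℕ
    ∑∑ f = ∑ E (λ y → ∑ E (f y))

    ∑∑-+ : ∀ f g → ∑∑ (λ y z → f y z ℕ.+ g y z) ≡ ∑∑ f ℕ.+ ∑∑ g
    ∑∑-+ f g = trans (∑-cong E (λ y → ∑-+ E (f y) (g y))) (∑-+ E _ _)

    ∑-y≡1 : ∑∑ y≡1 ≡ order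
    ∑-y≡1 = trans (∑-cong E (λ y → ∑-*ˡ E (𝟙 (y ≟ 1#)) β)) (∑-pick Carrier-finite 1# (λ _ → order))

    ∑-z≡1 : ∑∑ z≡1 ≡ order
    ∑-z≡1 = ∑-cong E (λ y → ∑-pick Carrier-finite 1# (λ _ → β y))

    ∑-y≡z : ∑∑ y≡z ≡ order
    ∑-y≡z = ∑-cong E (λ y → ∑-pick Carrier-finite y β)

    merge : ∀ y z → both y z ≡ β y ℕ.* (β z ℕ.* 𝟙 (¬? (Q y z ≟ 0#)))
    merge y z = trans (sym (ℕ.*-distribˡ-+ (β y) _ _)) (cong (β y ℕ.*_)
      (trans (sym (ℕ.*-distribˡ-+ (β z) _ _)) (cong (β z ℕ.*_) (residue+nonresidue (Q y z)))))

    β1 : β 1# ≡ 1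
    β1 = 𝟙-true (member? 1#) 1∈

    β*β : ∀ y → β y ℕ.* β y ≡ β y
    β*β y with member? y
    ... | yes _ = refl
    ... | no _ = refl

    -- A pair on two of the diagonals is (1, 1), which lies on all three; it is therefore counted
    -- twice too often, whence the term 2.
    diagonals : ∀ y z →
      β y ℕ.* (β z ℕ.* 𝟙 (¬? (Q y z ≟ 0#))) ℕ.+
        (𝟙 (y ≟ 1#) ℕ.* β z ℕ.+ (𝟙 (z ≟ 1#) ℕ.* β y ℕ.+ 𝟙 (z ≟ y) ℕ.* β z))
      ≡ β y ℕ.* β z ℕ.+ 𝟙 (y ≟ 1#) ℕ.* (𝟙 (z ≟ 1#) ℕ.* 2)
    diagonals y z with Q y z ≟ 0# | y ≟ 1# | z ≟ 1# | z ≟ y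
    ... | no Q≢0 | yes y≡1 | _ | _ = contradiction y≡1 (proj₁ (Q≢0⇒ Q≢0))
    ... | no Q≢0 | no _ | yes z≡1 | _ = contradiction z≡1 (proj₁ (proj₂ (Q≢0⇒ Q≢0)))
    ... | no Q≢0 | no _ | no _ | yes z≡y = contradiction (sym z≡y) (proj₂ (proj₂ (Q≢0⇒ Q≢0)))
    ... | no _ | no _ | no _ | no _ = cong (ℕ._+ 0) (cong (β y ℕ.*_) (ℕ.*-identityʳ (β z)))
    ... | yes _ | yes refl | yes refl | no 1≢1 = contradiction refl 1≢1
    ... | yes _ | yes refl | yes refl | yes _ rewrite β1 = refl
    ... | yes _ | yes refl | no z≢1 | yes z≡1 = contradiction z≡1 z≢1
    ... | yes _ | yes refl | no _ | no _ rewrite β1 | ℕ.*-zeroʳ (β z) = refl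
    ... | yes _ | no y≢1 | yes refl | yes 1≡y = contradiction (sym 1≡y) y≢1
    ... | yes _ | no _ | yes refl | no _ rewrite β1 =
      trans (cong (ℕ._+ (β y ℕ.+ 0 ℕ.+ 0)) (ℕ.*-zeroʳ (β y)))
        (trans (ℕ.+-identityʳ _) (trans (ℕ.+-identityʳ (β y)) (sym (trans (ℕ.+-identityʳ _) (ℕ.*-identityʳ (β y))))))
    ... | yes _ | no _ | no _ | yes refl rewrite ℕ.*-zeroʳ (β y) | ℕ.*-zeroʳ (β y) | β*β y = refl
    ... | yes Q≡0 | no y≢1 | no z≢1 | no z≢y = contradiction Q≡0
      (*-≢0 (*-≢0 (λ e → y≢1 (sym (x-y≡0⇒x≡y e))) (λ e → z≢y (sym (x-y≡0⇒x≡y e)))) (λ e → z≢1 (x-y≡0⇒x≡y e)))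

  Q-swap : ∀ {w} → SquareClassFunction w → ∀ y z → w (Q z y) ≡ w (Q y z)
  Q-swap {w} C y z = trans (cong w (solve 2 (λ y z →
      (:1 :- z) :* (z :- y) :* (y :- :1) := :- ((:1 :- y) :* (y :- z) :* (z :- :1))) refl y z))
    (w-neg C (Q y z))

  -- Clearing denominators costs the square (y z)² and leaves a sign, which is a square as well.
  Q-inverse : ∀ {w} → SquareClassFunction w → ∀ {y z} → y ≢ 0# → z ≢ 0# →
    w (Q (y ⁻¹) (z ⁻¹)) ≡ w (Q y z)
  Q-inverse {w} C {y} {z} y≢0 z≢0 = begin
    w (Q (y ⁻¹) (z ⁻¹))                        ≡⟨ square-* C (*-≢0 y≢0 z≢0) _ ⟨
    w (y * z * (y * z) * Q (y ⁻¹) (z ⁻¹))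
      ≡⟨ cong w (solve 4 (λ y z y′ z′ →
           y :* z :* (y :* z) :* ((:1 :- y′) :* (y′ :- z′) :* (z′ :- :1)) :=
           (y :- y :* y′) :* ((y :* y′) :* z :- (z :* z′) :* y) :* (z :* z′ :- z)) refl y z (y ⁻¹) (z ⁻¹)) ⟩
    w ((y - y * y ⁻¹) * (y * y ⁻¹ * z - z * z ⁻¹ * y) * (z * z ⁻¹ - z))
      ≡⟨ cong₂ (λ a b → w ((y - a) * (a * z - b * y) * (b - z))) (⁻¹-inverse y y≢0) (⁻¹-inverse z z≢0) ⟩
    w ((y - 1#) * (1# * z - 1# * y) * (1# - z))
      ≡⟨ cong w (solve 2 (λ y z → (y :- :1) :* (:1 :* z :- :1 :* y) :* (:1 :- z) :=
           :- ((:1 :- y) :* (y :- z) :* (z :- :1))) refl y z) ⟩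
    w (- Q y z)                                ≡⟨ w-neg C (Q y z) ⟩
    w (Q y z)                                  ∎
    where open ≡-Reasoning

  -- The cyclic shift of (1, y, z) to (y, z, 1), divided by y to make the first entry 1 again.
  rotate : Carrier × Carrier → Carrier × Carrier
  rotate (y , z) = z * y ⁻¹ , y ⁻¹

  -- `D` is unchanged by a cyclic shift, and renormalising divides it by y³, a square since y is
  -- one.
  Q-rotate : ∀ {w} → SquareClassFunction w → ∀ {y} → Member y → ∀ z →
    w (Q (z * y ⁻¹) (y ⁻¹)) ≡ w (Q y z)
  Q-rotate {w} C {y} y∈ z = begin
    w (Q (z * y ⁻¹) (y ⁻¹))
      ≡⟨ w-square C (*-≢0 (*-≢0 y≢0 y≢0) y≢0) cube-square refl ⟨
    w (y * y * y * Q (z * y ⁻¹) (y ⁻¹))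
      ≡⟨ cong w (solve 3 (λ y z y′ →
           y :* y :* y :* ((:1 :- z :* y′) :* (z :* y′ :- y′) :* (y′ :- :1)) :=
           (y :- z :* (y :* y′)) :* (z :* (y :* y′) :- y :* y′) :* (y :* y′ :- y)) refl y z (y ⁻¹)) ⟩
    w ((y - z * (y * y ⁻¹)) * (z * (y * y ⁻¹) - y * y ⁻¹) * (y * y ⁻¹ - y))
      ≡⟨ cong (λ a → w ((y - z * a) * (z * a - a) * (a - y))) (⁻¹-inverse y y≢0) ⟩
    w ((y - z * 1#) * (z * 1# - 1#) * (1# - y))
      ≡⟨ cong w (solve 2 (λ y z → (y :- z :* :1) :* (z :* :1 :- :1) :* (:1 :- y) :=
           (:1 :- y) :* (y :- z) :* (z :- :1)) refl y z) ⟩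
    w (Q y z) ∎
    where
    open ≡-Reasoning
    y≢0 = 0∉ y∈
    cube-square : IsSquare (y * y * y)
    cube-square with squares y∈
    ... | s , refl = s * s * s , solve 1 (λ s → s :* s :* (s :* s) :* (s :* s) := s :* s :* s :* (s :* s :* s)) refl s

  -- On the curve y z = 1 the class of Q y z only depends on y².
  Q-reciprocal : ∀ {w} → SquareClassFunction w → ∀ {y z} → y * z ≡ 1# → y ≢ 1# →
    w (Q y z) ≡ w (y * y - 1#)
  Q-reciprocal {w} C {y} {z} yz≡1 y≢1 = begin
    w (Q y z)
      ≡⟨ square-* C y≢0 _ ⟨
    w (y * y * Q y z)
      ≡⟨ cong w (solve 2 (λ y z → y :* y :* ((:1 :- y) :* (y :- z) :* (z :- :1)) :=
           (:1 :- y) :* (y :* y :- y :* z) :* (y :* z :- y)) refl y z) ⟩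
    w ((1# - y) * (y * y - y * z) * (y * z - y))
      ≡⟨ cong (λ a → w ((1# - y) * (y * y - a) * (a - y))) yz≡1 ⟩
    w ((1# - y) * (y * y - 1#) * (1# - y))
      ≡⟨ w-square C (*-≢0 1-y≢0 1-y≢0) (1# - y , refl)
           (solve 2 (λ a b → a :* a :* b := a :* b :* a) refl (1# - y) (y * y - 1#)) ⟩
    w (y * y - 1#) ∎
    where
    open ≡-Reasoning
    y≢0 = x*y≡1⇒x≢0 yz≡1
    1-y≢0 : 1# - y ≢ 0#
    1-y≢0 e = y≢1 (sym (x-y≡0⇒x≡y e))

  module _ {w : Carrier → ℕ} (C : SquareClassFunction w) where
    supported : ∀ {y z} → weight w (y , z) ≢ 0 → Member y × Member z × w (Q y z) ≢ 0
    supported {y} {z} s with m*n≢0⇒m≢0×n≢0 {β y} s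
    ... | βy≢0 , s′ with m*n≢0⇒m≢0×n≢0 {β z} s′
    ...   | βz≢0 , wQ≢0 = β≢0 βy≢0 , β≢0 βz≢0 , wQ≢0

    supported-distinct : ∀ {y z} → weight w (y , z) ≢ 0 → y ≢ 1# × z ≢ 1# × y ≢ z
    supported-distinct s = Q≢0⇒ (≢0 C (proj₂ (proj₂ (supported s))))

    weight-cong : ∀ {y z y′ z′} → Member y → Member z → Member y′ → Member z′ →
      w (Q y′ z′) ≡ w (Q y z) → weight w (y′ , z′) ≡ weight w (y , z)
    weight-cong {y} {z} {y′} {z′} y∈ z∈ y′∈ z′∈ e = cong₂ ℕ._*_ (both-1 y′∈ y∈) (cong₂ ℕ._*_ (both-1 z′∈ z∈) e)
      where
      both-1 : ∀ {a b} → Member a → Member b → β a ≡ β b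
      both-1 {a} {b} a∈ b∈ = 𝟙-cong (member? a) (member? b) (λ _ → b∈) (λ _ → a∈)

    weight-swap : ∀ {t} → weight w t ≢ 0 → weight w (swap t) ≡ weight w t
    weight-swap {y , z} s with supported s
    ... | y∈ , z∈ , _ = weight-cong y∈ z∈ z∈ y∈ (Q-swap C y z)

    2∣W : 2 ∣ W w
    2∣W = involution-divides pairs swap (weight w) weight-swap (λ _ → refl)
      (λ {t} s e → proj₂ (proj₂ (supported-distinct s)) (sym (proj₁ (,-injective e))))

    -- Without a fixed point in the support, the rotation would act freely there with order 3. The
    -- fixed point itself is found by exhaustive search, as later steps compute with it.
    rotation-fixed-point : ¬ 3 ∣ W w → ∃ λ t → weight w t ≢ 0 × rotate t ≡ t
    rotation-fixed-point 3∤W with any? (λ y → any? (λ z →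
        ¬? (weight w (y , z) ℕ.≟ 0) ×-dec Finite._≟_ pairs (rotate (y , z)) (y , z)))
    ... | yes (y , z , s , fixed) = (y , z) , s , fixed
    ... | no none = contradiction (order-three-divides pairs rotate (weight w)
      (λ { {y , z} s → let (y∈ , z∈ , _) = supported s in
        weight-cong y∈ z∈ (*-closed z∈ (⁻¹-closed y∈)) (⁻¹-closed y∈) (Q-rotate C y∈ z) })
      (λ { {y , z} s → let (y∈ , z∈ , _) = supported s in rotate³ (0∉ y∈) (0∉ z∈) })
      (λ { {y , z} s fixed → none (y , z , s , fixed) })) 3∤W
      where
      rotate³ : ∀ {y z} → y ≢ 0# → z ≢ 0# → rotate (rotate (rotate (y , z))) ≡ (y , z)
      rotate³ {y} {z} y≢0 z≢0 = cong₂ _,_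
          (trans (cong₂ _*_ [z/y]⁻¹ e) (trans (*-assoc _ _ _) (trans (cong (y *_) (⁻¹-inverseˡ z≢0)) (*-identityʳ y))))
          e
        where
        [z/y]⁻¹ : (z * y ⁻¹) ⁻¹ ≡ y * z ⁻¹
        [z/y]⁻¹ = sym (⁻¹-unique (trans
          (solve 4 (λ z y′ y z′ → z :* y′ :* (y :* z′) := (y :* y′) :* (z :* z′)) refl z (y ⁻¹) y (z ⁻¹))
          (trans (cong₂ _*_ (⁻¹-inverse y y≢0) (⁻¹-inverse z z≢0)) (*-identityˡ 1#))))
        z⁻¹ : y ⁻¹ * (z * y ⁻¹) ⁻¹ ≡ z ⁻¹
        z⁻¹ = trans (cong (y ⁻¹ *_) [z/y]⁻¹) (*-divideˡ y≢0 _)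
        e : (y ⁻¹ * (z * y ⁻¹) ⁻¹) ⁻¹ ≡ z
        e = trans (cong _⁻¹ z⁻¹) (⁻¹-involutive z≢0)

    -- Four-group actions when B contains -1 but none of its square roots.

    module _ (-1∈ : Member (- 1#)) (no-i : ∀ {x} → Member x → x * x ≢ - 1#) where
      neg∈ : ∀ {x} → Member x → Member (- x)
      neg∈ {x} x∈ = subst Member (solve 1 (λ x → (:- :1) :* x := :- x) refl x) (*-closed -1∈ x∈)

      reciprocal? : ∀ ((y , z) : Carrier × Carrier) → Dec (y * z ≡ 1#)
      reciprocal? (y , z) = y * z ≟ 1#

      -- Swap followed by inversion fixes exactly the pairs of nonzero elements with y z = 1, so
      -- those need another group.
      on off : Carrier × Carrier → ℕ
      on t = 𝟙 (reciprocal? t) ℕ.* weight w t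
      off t = 𝟙 (¬? (reciprocal? t)) ℕ.* weight w t

      invert negate : Carrier × Carrier → Carrier × Carrier
      invert (y , z) = y ⁻¹ , z ⁻¹
      negate (y , z) = - y , - z

      off-support : ∀ {y z} → off (y , z) ≢ 0 → y * z ≢ 1# × weight w (y , z) ≢ 0
      off-support {y} {z} s with m*n≢0⇒m≢0×n≢0 {𝟙 (¬? (reciprocal? (y , z)))} s
      ... | a , b = 𝟙-holds (¬? (reciprocal? (y , z))) a , b

      on-support : ∀ {y z} → on (y , z) ≢ 0 → y * z ≡ 1# × weight w (y , z) ≢ 0
      on-support {y} {z} s with m*n≢0⇒m≢0×n≢0 {𝟙 (reciprocal? (y , z))} s
      ... | a , b = 𝟙-holds (reciprocal? (y , z)) a , b

      self-inverse : ∀ {x} → Member x → x ⁻¹ ≡ x → x ≢ 1# → x ≡ - 1#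
      self-inverse {x} x∈ e x≢1 with x²≡y²⇒x≡±y {x} {1#}
        (trans (cong (x *_) (sym e)) (trans (⁻¹-inverse x (0∉ x∈)) (sym (*-identityˡ 1#))))
      ... | inj₁ x≡1 = contradiction x≡1 x≢1
      ... | inj₂ x≡-1 = x≡-1

      -- A pair fixed by inversion has entries that are self-inverse and different from 1, so both
      -- are -1, although they are distinct. A pair fixed by swap and inversion together satisfies y
      -- z = 1.
      4∣off : 4 ∣ ∑ (elements pairs) off
      4∣off = four-group-divides pairs swap invert off
        (λ { {y , z} s → let (yz≢1 , s′) = off-support s in cong₂ ℕ._*_
          (𝟙-cong (¬? (reciprocal? (z , y))) (¬? (reciprocal? (y , z)))
            (λ _ → yz≢1) (λ _ e → yz≢1 (trans (*-comm y z) e)))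
          (weight-swap s′) })
        (λ { {y , z} s → let (yz≢1 , s′) = off-support s ; (y∈ , z∈ , _) = supported s′ in cong₂ ℕ._*_
          (𝟙-cong (¬? (reciprocal? (y ⁻¹ , z ⁻¹))) (¬? (reciprocal? (y , z)))
            (λ _ → yz≢1) (λ _ e → yz≢1 (invert-reciprocal (0∉ y∈) (0∉ z∈) e)))
          (weight-cong y∈ z∈ (⁻¹-closed y∈) (⁻¹-closed z∈) (Q-inverse C (0∉ y∈) (0∉ z∈))) })
        (λ _ → refl)
        (λ { {y , z} s → let (_ , s′) = off-support s ; (y∈ , z∈ , _) = supported s′ in
          cong₂ _,_ (⁻¹-involutive (0∉ y∈)) (⁻¹-involutive (0∉ z∈)) })
        (λ _ → refl)
        (λ { {y , z} s e → let (_ , s′) = off-support s in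
          proj₂ (proj₂ (supported-distinct s′)) (sym (proj₁ (,-injective e))) })
        (λ { {y , z} s e → let (_ , s′) = off-support s
                               (y∈ , z∈ , _) = supported s′
                               (y≢1 , z≢1 , y≢z) = supported-distinct s′
                               (e₁ , e₂) = ,-injective e in
          y≢z (trans (self-inverse y∈ e₁ y≢1) (sym (self-inverse z∈ e₂ z≢1))) })
        (λ { {y , z} s e → let (yz≢1 , s′) = off-support s ; (y∈ , z∈ , _) = supported s′ in
          yz≢1 (trans (cong (y *_) (sym (proj₂ (,-injective e)))) (⁻¹-inverse y (0∉ y∈))) })
        where
        invert-reciprocal : ∀ {y z} → y ≢ 0# → z ≢ 0# → y ⁻¹ * z ⁻¹ ≡ 1# → y * z ≡ 1#
        invert-reciprocal {y} {z} y≢0 z≢0 e = begin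
          y * z                        ≡⟨ *-identityʳ _ ⟨
          y * z * 1#                   ≡⟨ cong (y * z *_) e ⟨
          y * z * (y ⁻¹ * z ⁻¹)        ≡⟨ solve 4 (λ y z y′ z′ → y :* z :* (y′ :* z′) := (y :* y′) :* (z :* z′)) refl y z (y ⁻¹) (z ⁻¹) ⟩
          y * y ⁻¹ * (z * z ⁻¹)        ≡⟨ cong₂ _*_ (⁻¹-inverse y y≢0) (⁻¹-inverse z z≢0) ⟩
          1# * 1#                      ≡⟨ *-identityˡ 1# ⟩
          1#                           ∎
          where open ≡-Reasoning

      -- Negation keeps y z = 1 and y², hence the class; the exceptional value y = -1 would force z
      -- = y. A pair fixed by swap and negation has z = -y, so y² = -1, which `no-i` excludes.
      4∣on : 4 ∣ ∑ (elements pairs) on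
      4∣on = four-group-divides pairs swap negate on
        (λ { {y , z} s → let (yz≡1 , s′) = on-support s in cong₂ ℕ._*_
          (𝟙-cong (reciprocal? (z , y)) (reciprocal? (y , z))
            (λ _ → yz≡1) (λ _ → trans (*-comm z y) yz≡1))
          (weight-swap s′) })
        (λ { {y , z} s → let (yz≡1 , s′) = on-support s
                             (y∈ , z∈ , _) = supported s′
                             (y≢1 , _ , y≢z) = supported-distinct s′
                             -y*-z≡1 = trans (neg*neg y z) yz≡1 in cong₂ ℕ._*_
          (𝟙-cong (reciprocal? (- y , - z)) (reciprocal? (y , z))
            (λ _ → yz≡1) (λ _ → -y*-z≡1))
          (weight-cong y∈ z∈ (neg∈ y∈) (neg∈ z∈)
            (trans (Q-reciprocal C -y*-z≡1 (λ -y≡1 → y≢z (-y≡1⇒y≡z yz≡1 -y≡1)))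
              (trans (cong (λ a → w (a - 1#)) (neg*neg y y)) (sym (Q-reciprocal C yz≡1 y≢1))))) })
        (λ _ → refl)
        (λ { {y , z} _ → cong₂ _,_ (neg-neg y) (neg-neg z) })
        (λ _ → refl)
        (λ { {y , z} s e → let (_ , s′) = on-support s in
          proj₂ (proj₂ (supported-distinct s′)) (sym (proj₁ (,-injective e))) })
        (λ { {y , z} s e → let (_ , s′) = on-support s ; (y∈ , _) = supported s′ in
          -x≢x (0∉ y∈) (proj₁ (,-injective e)) })
        (λ { {y , z} s e → let (yz≡1 , s′) = on-support s ; (y∈ , _) = supported s′ in
          no-i y∈ (trans (solve 1 (λ y → y :* y := :- (y :* (:- y))) refl y)
            (cong -_ (trans (cong (y *_) (proj₂ (,-injective e))) yz≡1))) })
        where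
        neg*neg : ∀ y z → - y * - z ≡ y * z
        neg*neg = solve 2 (λ y z → (:- y) :* (:- z) := y :* z) refl
        neg-neg : ∀ y → - (- y) ≡ y
        neg-neg = solve 1 (λ y → :- (:- y) := y) refl
        -y≡1⇒y≡z : ∀ {y z} → y * z ≡ 1# → - y ≡ 1# → y ≡ z
        -y≡1⇒y≡z {y} {z} yz≡1 -y≡1 = trans y≡-1 (sym (trans
          (solve 1 (λ z → z := :- ((:- :1) :* z)) refl z)
          (cong -_ (trans (cong (_* z) (sym y≡-1)) yz≡1))))
          where
          y≡-1 : y ≡ - 1#
          y≡-1 = trans (sym (neg-neg y)) (cong -_ -y≡1)

      4∣W : 4 ∣ W w
      4∣W = subst (4 ∣_) (trans (sym (∑-+ (elements pairs) on off)) (∑-cong (elements pairs) split))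
        (∣m∣n⇒∣m+n 4∣on 4∣off)
        where
        split : ∀ t → on t ℕ.+ off t ≡ weight w t
        split (y , z) with y * z ≟ 1#
        ... | yes _ = trans (ℕ.+-identityʳ _) (ℕ.*-identityˡ (weight w (y , z)))
        ... | no _ = ℕ.*-identityˡ (weight w (y , z))

  -- Inversion fixes no elements but 1 and -1. Were -1 missing, it would pair off the members other
  -- than 1 and the order would be odd.
  even-order⇒-1∈ : 2 ∣ order → Member (- 1#)
  even-order⇒-1∈ 2∣k with member? (- 1#)
  ... | yes -1∈ = -1∈
  ... | no -1∉ = contradiction (∣1⇒≡1 (∣m+n∣m⇒∣n (subst (2 ∣_) split 2∣k)
      (involution-divides Carrier-finite _⁻¹ f
        (λ {x} s → let (x∈ , x≢1) = 𝟙-holds (other? x) s in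
          𝟙-cong (other? (x ⁻¹)) (other? x) (λ _ → x∈ , x≢1)
            (λ _ → ⁻¹-closed x∈ , λ e → x≢1 (trans (sym (⁻¹-involutive (0∉ x∈))) (trans (cong _⁻¹ e) ⁻¹-1#))))
        (λ {x} s → ⁻¹-involutive (0∉ (proj₁ (𝟙-holds (other? x) s))))
        (λ {x} s e → let (x∈ , x≢1) = 𝟙-holds (other? x) s in
          [ x≢1 , (λ { refl → -1∉ x∈ }) ]′ (x²≡y²⇒x≡±y {x} {1#}
            (trans (cong (x *_) (sym e)) (trans (⁻¹-inverse x (0∉ x∈)) (sym (*-identityˡ 1#))))))))) λ ()
    where
    other? : ∀ x → Dec (Member x × x ≢ 1#)
    other? x = member? x ×-dec ¬? (x ≟ 1#)

    f : Carrier → ℕ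
    f x = 𝟙 (other? x)

    pointwise : ∀ x → β x ≡ f x ℕ.+ 𝟙 (x ≟ 1#)
    pointwise x with member? x | x ≟ 1#
    ... | yes _ | yes _ = refl
    ... | yes _ | no _ = refl
    ... | no 1∉ | yes refl = contradiction 1∈ 1∉
    ... | no _ | no _ = refl

    split : order ≡ ∑ E f ℕ.+ 1
    split = trans (∑-cong E pointwise) (trans (∑-+ E f _) (cong (∑ E f ℕ.+_) (once Carrier-finite 1#)))

  -- Multiplication by i permutes the subgroup with order 4, and its square, negation, fixes no
  -- nonzero element.
  i∈⇒4∣order : ∀ {i} → Member i → i * i ≡ - 1# → 4 ∣ order
  i∈⇒4∣order {i} i∈ i²≡-1 = order-four-divides Carrier-finite (i *_) β
    (λ {x} s → 𝟙-cong (member? (i * x)) (member? x) (λ _ → β≢0 s) (*-closed i∈))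
    (λ {x} _ → trans (i*i* (i * (i * x))) (trans (cong -_ (i*i* x)) (solve 1 (λ x → :- (:- x) := x) refl x)))
    (λ {x} s e → -x≢x (0∉ (β≢0 s)) (trans (sym (i*i* x)) e))
    where
    i*i* : ∀ x → i * (i * x) ≡ - x
    i*i* x = trans (sym (*-assoc i i x)) (trans (cong (_* x) i²≡-1) (solve 1 (λ x → (:- :1) :* x := :- x) refl x))

  module _ (balanced : W residue ≡ W nonresidue) where
    2W+3k≡k²+2 : 2 ℕ.* W residue ℕ.+ 3 ℕ.* order ≡ order ℕ.* order ℕ.+ 2
    2W+3k≡k²+2 = trans (cong (λ h → W residue ℕ.+ h ℕ.+ 3 ℕ.* order)
      (trans (ℕ.+-identityʳ (W residue)) balanced)) count-pairs

    -- A fixed point (y , z) of the rotation consists of the two primitive cube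
    -- roots of unity, so it is unique up to swapping and has only one class.
    3∤order : ¬ 3 ∣ order
    3∤order 3∣k with rotation-fixed-point residue-class 3∤W
                   | rotation-fixed-point nonresidue-class (λ 3∣W → 3∤W (subst (3 ∣_) (sym balanced) 3∣W))
      where
      -- If 3 divided both k and W, the equation would leave 3 | 2.
      3∤W : ¬ 3 ∣ W residue
      3∤W 3∣W = contradiction (∣m+n∣m⇒∣n (subst (3 ∣_) 2W+3k≡k²+2
        (∣m∣n⇒∣m+n (∣n⇒∣m*n 2 3∣W) (m∣m*n order))) (∣m⇒∣m*n order 3∣k)) (from-no (3 ∣? 2))
    ... | (y , z) , s , fixed | (y′ , z′) , s′ , fixed′ = compare
      where
      y∈ = proj₁ (supported residue-class s)
      y′∈ = proj₁ (supported nonresidue-class s′)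

      -- Being fixed means z/y = y and 1/y = z, so z = y² and y³ = 1; since y is not 1, it is a root
      -- of y² + y + 1.
      cube-root : ∀ {y z} → Member y → rotate (y , z) ≡ (y , z) → y ≢ 1# → z ≡ y * y × y * y + y + 1# ≡ 0#
      cube-root {y} {z} y∈ fixed y≢1 = z≡y² , [ (λ e → contradiction (x-y≡0⇒x≡y e) y≢1) , (λ e → e) ]′
          (x*y≡0⇒x≡0∨y≡0 (trans
            (solve 1 (λ y → (y :- :1) :* (y :* y :+ y :+ :1) := y :* (y :* y) :- :1) refl y)
            (x≡y⇒x-y≡0 (trans (cong (y *_) (sym z≡y²))
              (trans (cong (y *_) (sym (proj₂ (,-injective fixed)))) (⁻¹-inverse y (0∉ y∈)))))))
        where
        z≡y² : z ≡ y * y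
        z≡y² = trans (sym (trans (*-assoc z (y ⁻¹) y) (trans (cong (z *_) (⁻¹-inverseˡ (0∉ y∈))) (*-identityʳ z))))
          (cong (_* y) (proj₁ (,-injective fixed)))

      root = cube-root y∈ fixed (proj₁ (supported-distinct residue-class s))
      root′ = cube-root y′∈ fixed′ (proj₁ (supported-distinct nonresidue-class s′))

      is-residue : residue (Q y z) ≢ 0
      is-residue = proj₂ (proj₂ (supported residue-class s))

      is-nonresidue : nonresidue (Q y′ z′) ≢ 0
      is-nonresidue = proj₂ (proj₂ (supported nonresidue-class s′))

      clash : nonresidue (Q y z) ≢ 0 → _
      clash ≢0 = proj₂ (𝟙-holds (nonresidue? (Q y z)) ≢0) (proj₂ (𝟙-holds (residue? (Q y z)) is-residue))

      z≡ : z ≡ y ⁻¹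
      z≡ = sym (proj₂ (,-injective fixed))
      z′≡ : z′ ≡ y′ ⁻¹
      z′≡ = sym (proj₂ (,-injective fixed′))

      -- Subtracting the two quadratics, y′ is either y or the other root -1 - y, which is y² = z.
      -- Hence the second pair is the first or its swap, and one value would be both a square and a
      -- nonsquare.
      compare : _
      compare with x*y≡0⇒x≡0∨y≡0 (trans
        (solve 2 (λ y y′ → (y :- y′) :* (y :+ y′ :+ :1) := (y :* y :+ y :+ :1) :- (y′ :* y′ :+ y′ :+ :1)) refl y y′)
        (x≡y⇒x-y≡0 (trans (proj₂ root) (sym (proj₂ root′)))))
      ... | inj₁ y-y′≡0 = clash (subst (λ t → nonresidue t ≢ 0)
        (sym (cong₂ Q y≡y′ (trans z≡ (trans (cong _⁻¹ y≡y′) (sym z′≡))))) is-nonresidue)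
        where y≡y′ = x-y≡0⇒x≡y y-y′≡0
      ... | inj₂ y+y′+1≡0 = clash (λ e → is-nonresidue (trans
          (cong nonresidue (cong₂ Q y′≡z (trans z′≡ (trans (cong _⁻¹ y′≡z)
            (trans (cong _⁻¹ z≡) (⁻¹-involutive (0∉ y∈)))))))
          (trans (Q-swap nonresidue-class y z) e)))
        where
        y′≡z : y′ ≡ z
        y′≡z = x-y≡0⇒x≡y (trans (cong (λ a → y′ - a) (proj₁ root)) (trans
          (solve 2 (λ y y′ → y′ :- y :* y := (y :+ y′ :+ :1) :- (y :* y :+ y :+ :1)) refl y y′)
          (x≡y⇒x-y≡0 (trans y+y′+1≡0 (sym (proj₂ root))))))

    -- As W is even, 4 | k would leave 4 | 2 in the equation. So the subgroup contains no square
    -- root of -1, which would force 4 | k, and the four-group actions are free.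
    even-order⇒4∣W : 2 ∣ order → 4 ∣ W residue
    even-order⇒4∣W 2∣k = 4∣W residue-class (even-order⇒-1∈ 2∣k) λ x∈ x²≡-1 → 4∤k (i∈⇒4∣order x∈ x²≡-1)
      where
      4∤k : ¬ 4 ∣ order
      4∤k 4∣k with 2∣W residue-class
      ... | divides h W≡h*2 = contradiction (∣m+n∣m⇒∣n (subst (4 ∣_) 2W+3k≡k²+2
        (∣m∣n⇒∣m+n (divides h (trans (cong (2 ℕ.*_) W≡h*2) (lemma h))) (∣n⇒∣m*n 3 4∣k)))
        (∣m⇒∣m*n order 4∣k)) (from-no (4 ∣? 2))
        where
        lemma : ∀ h → 2 ℕ.* (h ℕ.* 2) ≡ h ℕ.* 4
        lemma = solve-∀

-- The given subset as a multiplicative subgroup.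

module _ {q : ℕ} (F : FiniteField q) where
  open Field F

  toSubgroup : ∀ {B k} → IsSubgroupOfOrder F B k → Subgroup
  toSubgroup {B} (0∉B , (i₁ , elt-i₁ , i₁∈) , *-closed , ⁻¹-closed , _) = record
    { Member = λ x → index x ∈ₛ B
    ; member? = λ x → index x ∈? B
    ; 0∉ = λ { x∈ refl → 0∉B (index 0#) (elt-index 0#) x∈ }
    ; 1∈ = subst (_∈ₛ B) (trans (sym (index-elt i₁)) (cong index elt-i₁)) i₁∈
    ; *-closed = λ {x} {y} x∈ y∈ → *-closed (index x) (index y) _ x∈ y∈
        (trans (elt-index _) (sym (cong₂ _*_ (elt-index x) (elt-index y))))
    ; ⁻¹-closed = λ {x} x∈ → ⁻¹-closed (index x) _ x∈
        (trans (elt-index _) (cong _⁻¹ (sym (elt-index x))))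
    }

-- Residues of k modulo 24.

open Data.Nat using (_*_)

Admissible : ℕ → Set
Admissible r = r ≡ 1 ⊎ r ≡ 2 ⊎ r ≡ 5 ⊎ r ≡ 10 ⊎ r ≡ 13 ⊎ r ≡ 17

admissible? : ∀ r → Dec (Admissible r)
admissible? r = r ℕ.≟ 1 ⊎-dec r ℕ.≟ 2 ⊎-dec r ℕ.≟ 5 ⊎-dec r ℕ.≟ 10 ⊎-dec r ℕ.≟ 13 ⊎-dec r ℕ.≟ 17

-- Modulo 4 the equation leaves i ≡ 1 or 2, modulo 8 the even i narrow to i ≡ 2, and removing the
-- multiples of 3 leaves the six residues. The check is by exhaustion.
residue-check : ∀ (i : Fin 24) → ¬ 3 ∣ toℕ i →
  (3 * toℕ i % 4 ≡ (toℕ i * toℕ i ℕ.+ 2) % 4) →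
  (2 ∣ toℕ i → 3 * toℕ i % 8 ≡ (toℕ i * toℕ i ℕ.+ 2) % 8) → Admissible (toℕ i)
residue-check = from-yes (Fin.all? {24} λ i →
  ¬? (3 ∣? toℕ i) →-dec
  (3 * toℕ i % 4 ℕ.≟ (toℕ i * toℕ i ℕ.+ 2) % 4) →-dec
  (2 ∣? toℕ i →-dec 3 * toℕ i % 8 ℕ.≟ (toℕ i * toℕ i ℕ.+ 2) % 8) →-dec
  admissible? (toℕ i))

-- The equation is 2W = (k - 1)(k - 2) with no subtraction.
order-mod-24 : ∀ {k W} → 2 * W ℕ.+ 3 * k ≡ k * k ℕ.+ 2 → ¬ 3 ∣ k → 2 ∣ W →
  (2 ∣ k → 4 ∣ W) → Admissible (k % 24)
order-mod-24 {k} {W} eq 3∤k 2∣W 4∣W = subst Admissible toℕ-i (residue-check i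
    (λ 3∣i → 3∤k (lift 3 8 refl 3∣i))
    -- Doubling W gains a factor 2, so 2 | W and 4 | W justify the moduli 4 and 8.
    (reduce 4 6 refl (*-monoʳ-∣ 2 2∣W))
    (λ 2∣i → reduce 8 3 refl (*-monoʳ-∣ 2 (4∣W (lift 2 12 refl 2∣i)))))
  where
  r = k % 24
  t = k / 24
  i = fromℕ< (m%n<n k 24)

  toℕ-i : toℕ i ≡ r
  toℕ-i = Fin.toℕ-fromℕ< (m%n<n k 24)

  k≡ : k ≡ toℕ i ℕ.+ t * 24
  k≡ = trans (m≡m%n+[m/n]*n k 24) (cong (ℕ._+ t * 24) (sym toℕ-i))

  lift : ∀ d e → d * e ≡ 24 → d ∣ toℕ i → d ∣ k
  lift d e de≡24 d∣i = subst (d ∣_) (sym k≡)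
    (∣m∣n⇒∣m+n d∣i (∣n⇒∣m*n t (subst (d ∣_) de≡24 (m∣m*n e))))

  -- Since m divides 24, replacing k by its residue changes both sides by multiples of m, while 2W
  -- vanishes modulo m.
  reduce : ∀ m e .⦃ _ : ℕ.NonZero m ⦄ → e * m ≡ 24 → m ∣ 2 * W →
    3 * toℕ i % m ≡ (toℕ i * toℕ i ℕ.+ 2) % m
  reduce m e em≡24 (divides h 2W≡hm) = begin
    3 * toℕ i % m                                         ≡⟨ [m+kn]%n≡m%n (3 * toℕ i) (h ℕ.+ 3 * (t * e)) m ⟨
    (3 * toℕ i ℕ.+ (h ℕ.+ 3 * (t * e)) * m) % m           ≡⟨ cong (_% m) (begin
      3 * toℕ i ℕ.+ (h ℕ.+ 3 * (t * e)) * m                 ≡⟨ expandˡ (toℕ i) h t e m ⟩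
      h * m ℕ.+ 3 * (toℕ i ℕ.+ t * (e * m))                 ≡⟨ cong₂ (λ a b → a ℕ.+ 3 * b) (sym 2W≡hm) back ⟩
      2 * W ℕ.+ 3 * k                                       ≡⟨ eq ⟩
      k * k ℕ.+ 2                                           ≡⟨ cong (λ b → b * b ℕ.+ 2) back ⟨
      (toℕ i ℕ.+ t * (e * m)) * (toℕ i ℕ.+ t * (e * m)) ℕ.+ 2
                                                            ≡⟨ expandʳ (toℕ i) t e m ⟩
      toℕ i * toℕ i ℕ.+ 2 ℕ.+ (2 * toℕ i * (t * e) ℕ.+ t * e * (t * e) * m) * m ∎) ⟩
    (toℕ i * toℕ i ℕ.+ 2 ℕ.+ (2 * toℕ i * (t * e) ℕ.+ t * e * (t * e) * m) * m) % m
                                                          ≡⟨ [m+kn]%n≡m%n (toℕ i * toℕ i ℕ.+ 2) (2 * toℕ i * (t * e) ℕ.+ t * e * (t * e) * m) m ⟩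
    (toℕ i * toℕ i ℕ.+ 2) % m                             ∎
    where
    open ≡-Reasoning
    back : toℕ i ℕ.+ t * (e * m) ≡ k
    back = trans (cong (λ a → toℕ i ℕ.+ t * a) em≡24) (sym k≡)
    expandˡ : ∀ r h t e m → 3 * r ℕ.+ (h ℕ.+ 3 * (t * e)) * m ≡ h * m ℕ.+ 3 * (r ℕ.+ t * (e * m))
    expandˡ = solve-∀
    expandʳ : ∀ r t e m → (r ℕ.+ t * (e * m)) * (r ℕ.+ t * (e * m)) ℕ.+ 2 ≡
      r * r ℕ.+ 2 ℕ.+ (2 * r * (t * e) ℕ.+ t * e * (t * e) * m) * m
    expandʳ = solve-∀

theorem3p1 : (q k : ℕ) → IsPrimePower q → q % 4 ≡ 1 →
    (Σ ℕ λ m → q ∸ 1 ≡ k * m × 2 ∣ m) → 3 < k → k < q ∸ 1 →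
    (F : FiniteField q) → (B : Subset q) → IsSubgroupOfOrder F B k →
    Gives3Design F B →
    k % 24 ≡ 1 ⊎ k % 24 ≡ 2 ⊎ k % 24 ≡ 5 ⊎ k % 24 ≡ 10 ⊎ k % 24 ≡ 13 ⊎ k % 24 ≡ 17
theorem3p1 q k _ q%4≡1 (m , q-1≡km , divides h m≡h2) _ _ F B subgroup design =
  subst (λ k → Admissible (k % 24)) order≡k
    (order-mod-24 {order} {S.W residue} (S.2W+3k≡k²+2 W-balanced) (S.3∤order W-balanced) (S.2∣W residue-class)
      (S.even-order⇒4∣W W-balanced))
  where
  open ProjectiveLine F q%4≡1 using (residue; nonresidue; residue-class; nonresidue-class; module Design)
  G = toSubgroup F subgroup
  open Field.Subgroup G using (order; order≢0)

  order≡k : order ≡ k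
  order≡k = trans (Design.∑β≡∣B∣ B) (proj₂ (proj₂ (proj₂ (proj₂ subgroup))))

  -- This is where the evenness of (q - 1)/k enters; it makes every member of B a square.
  2k∣q-1 : 2 * order ∣ q ∸ 1
  2k∣q-1 = divides h (begin
    q ∸ 1          ≡⟨ q-1≡km ⟩
    k * m          ≡⟨ cong₂ _*_ (sym order≡k) m≡h2 ⟩
    order * (h * 2) ≡⟨ rearrange order h ⟩
    h * (2 * order) ∎)
    where
    open ≡-Reasoning
    rearrange : ∀ a h → a * (h * 2) ≡ h * (2 * a)
    rearrange = solve-∀

  module S = SquareSubgroup F q%4≡1 G (Field.small-subgroup-square F G 2k∣q-1)

  -- The triple sums of the design and of the subgroup are definitionally equal, as both test
  -- membership of `index x` in B; the common factor k is then cancelled.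
  W-balanced : S.W residue ≡ S.W nonresidue
  W-balanced = ℕ.*-cancelˡ-≡ _ _ order ⦃ ℕ.≢-nonZero order≢0 ⦄
    (trans (sym (S.∑G³≡order*W residue-class))
      (trans (Design.balanced B design) (S.∑G³≡order*W nonresidue-class)))
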